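{- Let $p,q,r\in\mathbb{N}$ (with $0\in\mathbb{N}$), and let $A,B\subset\mathbb{S}$ be finite disjoint sets with $|A|=n$, $|B|=m$, $n>m$. Let $C=\sum_{i=0}^{2^p-1} Z_{p,q,r}(A,B,i)$ be the number of collisions between the HyperMinHash sketches of $A$ and $B$. Then $$\operatorname{Var}(C)\le \mathbb{E}[C]^2+\mathbb{E}[C].$$
   Context: $\mathbb{S}$ is a universe of hashable objects, and $h:\mathbb{S}\to[0,1]$ is a uniformly random hash function (random oracle, shared by all sets): the values $h(a)$, $a\in\mathbb{S}$, are independent and uniform on $[0,1]$. Expectation and variance are over $h$. For $x\in(0,1)$ let $\rho_q(x)=\min(\lfloor-\log_2 x\rfloor+1,\,2^q)$ and $\sigma_r(x)=\lfloor x2^r\rfloor$. Define $\hat h_{q,r}(x)=\left(\rho_q(x),\ \sigma_r(x2^{\rho_q(x)}-1)\right)$ if $\rho_q(x)<2^q$, and $\hat h_{q,r}(x)=\left(2^q,\ \sigma_r(x2^{2^q-1})\right)$ if $\rho_q(x)=2^q$. Up to probability-zero boundary events, the values lie in $\{1,\dots,2^q\}\times\{0,\dots,2^r-1\}$, the second factor being identified with $\{0,1\}^r$. The HyperMinHash sketch of a finite set $A$ has $2^p$ buckets; for $i\in\{0,\dots,2^p-1\}$ the $i$th bucket is $$f_{p,q,r}(A)_i=\hat h_{q,r}\left[\min_{a\in A,\ i2^{ -p}<h(a)<(i+1)2^{ -p}}\left(h(a)2^p-i\right)\right].$$ If no $a\in A$ has $h(a)\in(i2^{ -p},(i+1)2^{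 -p})$, the bucket is called empty. For disjoint $A,B$, $Z_{p,q,r}(A,B,i)$ is the indicator of a collision in bucket $i$: it equals $1$ if bucket $i$ is nonempty for both $A$ and $B$ and $f_{p,q,r}(A)_i=f_{p,q,r}(B)_i$, and $0$ otherwise. -}

module Defs where

open import Algebra.Bundles using (CommutativeRing; Semiring)
import Algebra.Definitions.RawMonoid as RawMonoidDefs
import Algebra.Definitions.RawSemiring as RawSemiringDefs
open import Data.Bool.Base using (if_then_else_)
open import Data.Fin.Base as Fin using (Fin; toℕ)
open import Data.Integer.Base using (ℤ; +_; -[1+_]; ∣_∣)
import Data.Integer.Properties as ℤₚ
import Data.List.Extrema as Extrema
open import Data.List.Base using (List; []; _∷_; map; filter)
open import Data.Maybe.Base as Maybe using (Maybe; just; nothing)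
open import Data.Nat.Base as ℕ using (ℕ; zero; suc; z≤n; s≤s)
import Data.Nat.Properties as ℕₚ
open import Data.Product.Base using (_×_; _,_; ∃)
import Data.Product.Properties as ×ₚ
open import Data.Vec.Functional using (Vector)
open import Function.Base using (_∘_)
open import Function.Definitions using (Injective)
open import Level using (0ℓ)
open import Relation.Binary.Bundles using (DecTotalOrder)
import Relation.Binary.Construct.NonStrictToStrict as ToStrict
open import Relation.Binary.Core using (Rel)
open import Relation.Binary.PropositionalEquality.Core using (_≡_; _≢_)
open import Relation.Binary.Structures using (IsDecTotalOrder)
open import Relation.Nullary using (¬_; Dec; does; yes; no)
open import Relation.Nullary.Decidable using (_×-dec_)
open import Relation.Unary using (Pred; U; ∅; ∁; _⊢_; ⋃; _≐_; _∈_)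

record OrderedField : Set₁ where
  field
    commutativeRing : CommutativeRing 0ℓ 0ℓ

  open CommutativeRing commutativeRing public
    renaming (Carrier to ℝ; zero to *-zero)

  infix 4 _≤_
  infix 8 _⁻¹

  field
    _≤_             : Rel ℝ 0ℓ
    isDecTotalOrder : IsDecTotalOrder _≈_ _≤_
    +-monoʳ-≤       : ∀ x {y z} → y ≤ z → x + y ≤ x + z
    *-nonneg        : ∀ {x y} → 0# ≤ x → 0# ≤ y → 0# ≤ x * y
    0≉1             : ¬ (0# ≈ 1#)
    _⁻¹             : ℝ → ℝ
    *-inverseʳ      : ∀ x → ¬ (x ≈ 0#) → x * x ⁻¹ ≈ 1#

  decTotalOrder : DecTotalOrder 0ℓ 0ℓ 0ℓ
  decTotalOrder = record { isDecTotalOrder = isDecTotalOrder }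

  open DecTotalOrder decTotalOrder public
    using (totalOrder; _≤?_) renaming (_≟_ to _≈?_)

  open ToStrict _≈_ _≤_ public using (_<_)

  _<?_ : ∀ x y → Dec (x < y)
  _<?_ = ToStrict.<-decidable _≈_ _≤_ _≈?_ _≤?_

  open RawMonoidDefs +-rawMonoid public
    using (sum) renaming (_×_ to _⨉_)
  open RawSemiringDefs (Semiring.rawSemiring semiring) public
    using (_^_; product)

  fromℕ : ℕ → ℝ
  fromℕ n = n ⨉ 1#

  fromℤ : ℤ → ℝ
  fromℤ (+ n)    = fromℕ n
  fromℤ -[1+ n ] = - fromℕ (suc n)

  2# : ℝ
  2# = fromℕ 2

  UpperBound : Pred ℝ 0ℓ → ℝ → Set
  UpperBound A b = ∀ x → A x → x ≤ b

-- The real numbers of classical mathematics, as a complete ordered field.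
-- Decidability of the order is the classical reading.  The functions ⌊_⌋ and
-- log₂ (the latter on positive reals) are uniquely determined by their
-- specifications and exist in every complete ordered field, so bundling them
-- is no restriction; _⁻¹ and log₂ are total functions whose values outside
-- the nonzero, respectively positive, reals are unspecified.

record Reals : Set₁ where
  field
    orderedField : OrderedField

  open OrderedField orderedField public

  infix 4 _⟶_

  field
    complete   : (A : Pred ℝ 0ℓ) → ∃ A → ∃ (UpperBound A) →
                 ∃ λ s → UpperBound A s × (∀ b → UpperBound A b → s ≤ b)

    ⌊_⌋        : ℝ → ℤ
    ⌊⌋-lower   : ∀ x → fromℤ ⌊ x ⌋ ≤ x
    ⌊⌋-upper   : ∀ x → x < fromℤ ⌊ x ⌋ + 1#

    log₂       : ℝ → ℝ
    log₂-cong  : ∀ {x y} → x ≈ y → log₂ x ≈ log₂ y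
    log₂-mono  : ∀ {x y} → 0# < x → x < y → log₂ x < log₂ y
    log₂-*     : ∀ {x y} → 0# < x → 0# < y → log₂ (x * y) ≈ log₂ x + log₂ y
    log₂-2     : log₂ 2# ≈ 1#

  _⟶_ : (ℕ → ℝ) → ℝ → Set
  s ⟶ l = ∀ ε → 0# < ε →
    ∃ λ N → ∀ n → N ℕ.≤ n → (s n < l + ε) × (l < s n + ε)

  partialSum : (ℕ → ℝ) → ℕ → ℝ
  partialSum t n = sum {n} (t ∘ toℕ)

  minimum : List ℝ → Maybe ℝ
  minimum []       = nothing
  minimum (x ∷ xs) = just (Extrema.min totalOrder x xs)

  data Borel : Pred ℝ 0ℓ → Set₁ where
    ray        : ∀ t → Borel (_≤ t)
    complement : ∀ {B} → Borel B → Borel (∁ B)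
    union      : ∀ (B : ℕ → Pred ℝ 0ℓ) → (∀ k → Borel (B k)) → Borel (⋃ ℕ B)
    resp-≐     : ∀ {B B′} → B ≐ B′ → Borel B → Borel B′

-- ℙ is a total function on subsets of Ω, but its values on non-measurable sets
-- carry no information: apart from respecting equality of sets, the axioms
-- constrain it on measurable sets only.

record ProbabilitySpace (R : Reals) : Set₂ where
  open Reals R
  field
    Ω            : Set
    Measurable   : Pred Ω 0ℓ → Set₁
    measurable-U : Measurable U
    measurable-∁ : ∀ {E} → Measurable E → Measurable (∁ E)
    measurable-⋃ : ∀ (E : ℕ → Pred Ω 0ℓ) → (∀ k → Measurable (E k)) →
                   Measurable (⋃ ℕ E)
    measurable-≐ : ∀ {E F} → E ≐ F → Measurable E → Measurable F

    ℙ            : Pred Ω 0ℓ → ℝ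
    ℙ-≐          : ∀ {E F} → E ≐ F → ℙ E ≈ ℙ F
    ℙ-nonneg     : ∀ {E} → Measurable E → 0# ≤ ℙ E
    ℙ-∅          : ℙ ∅ ≈ 0#
    ℙ-U          : ℙ U ≈ 1#
    ℙ-⋃          : ∀ (E : ℕ → Pred Ω 0ℓ) → (∀ k → Measurable (E k)) →
                   (∀ {j k} → j ≢ k → ∀ ω → ¬ (ω ∈ E j × ω ∈ E k)) →
                   partialSum (ℙ ∘ E) ⟶ ℙ (⋃ ℕ E)

  -- The expectation of g(X) for a random variable X with values in {0,…,b}.
  𝔼 : (X : Ω → ℕ) {b : ℕ} → (∀ ω → X ω ℕ.≤ b) → (ℕ → ℝ) → ℝ
  𝔼 X {b} _ g = sum {suc b} (λ k → g (toℕ k) * ℙ (λ ω → X ω ≡ toℕ k))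

  Mean : (X : Ω → ℕ) {b : ℕ} → (∀ ω → X ω ℕ.≤ b) → ℝ
  Mean X X≤b = 𝔼 X X≤b fromℕ

  Var : (X : Ω → ℕ) {b : ℕ} → (∀ ω → X ω ℕ.≤ b) → ℝ
  Var X X≤b = 𝔼 X X≤b (λ k → (fromℕ k - Mean X X≤b) ^ 2)

-- Independence is that of the whole family (h a)ₐ: every finite subfamily
-- factorises over Borel sets.

record IsRandomHash {R : Reals} (P : ProbabilitySpace R) {𝕊 : Set}
  (h : 𝕊 → ProbabilitySpace.Ω P → Reals.ℝ R) : Set₁ where
  open Reals R
  open ProbabilitySpace P
  field
    lower       : ∀ a ω → 0# ≤ h a ω
    upper       : ∀ a ω → h a ω ≤ 1#
    measurable  : ∀ a {B} → Borel B → Measurable (h a ⊢ B)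
    uniform     : ∀ a t → 0# ≤ t → t ≤ 1# → ℙ (λ ω → h a ω ≤ t) ≈ t
    independent : ∀ {n} (a : Vector 𝕊 n) → Injective _≡_ _≡_ a →
                  (B : Vector (Pred ℝ 0ℓ) n) → (∀ i → Borel (B i)) →
                  ℙ (λ ω → ∀ i → h (a i) ω ∈ B i)
                    ≈ product (λ i → ℙ (h (a i) ⊢ B i))

module HyperMinHash (R : Reals) where
  open Reals R
  open RawMonoidDefs ℕ.+-0-rawMonoid using () renaming (sum to sumℕ)

  -- For x in (0,1), the only arguments that occur, ⌊ - log₂ x ⌋ is nonnegative,
  -- so that ∣_∣ merely converts it to a natural number.
  ρ : ℕ → ℝ → ℕ
  ρ q x = (∣ ⌊ - log₂ x ⌋ ∣ ℕ.+ 1) ℕ.⊓ (2 ℕ.^ q)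

  σ : ℕ → ℝ → ℤ
  σ r x = ⌊ x * 2# ^ r ⌋

  ĥ : (q r : ℕ) → ℝ → ℕ × ℤ
  ĥ q r x with ρ q x ℕₚ.<? 2 ℕ.^ q
  ... | yes _ = ρ q x , σ r (x * 2# ^ ρ q x - 1#)
  ... | no  _ = 2 ℕ.^ q , σ r (x * 2# ^ (2 ℕ.^ q ℕ.∸ 1))

  InBucket : (p : ℕ) → Fin (2 ℕ.^ p) → Pred ℝ 0ℓ
  InBucket p i y = (fromℕ (toℕ i) * (2# ^ p) ⁻¹ < y)
                 × (y < fromℕ (suc (toℕ i)) * (2# ^ p) ⁻¹)

  inBucket? : ∀ p i y → Dec (InBucket p i y)
  inBucket? p i y = (_ <? _) ×-dec (_ <? _)

  _≟ᵛ_ : (u v : ℕ × ℤ) → Dec (u ≡ v)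
  _≟ᵛ_ = ×ₚ.≡-dec ℕₚ._≟_ ℤₚ._≟_

  collision : Maybe (ℕ × ℤ) → Maybe (ℕ × ℤ) → ℕ
  collision (just u) (just v) = if does (u ≟ᵛ v) then 1 else 0
  collision _        _        = 0

  -- A hash function is fixed; finite sets are duplicate-free lists, and
  -- nothing stands for an empty bucket.
  module _ {𝕊 : Set} (h : 𝕊 → ℝ) (p q r : ℕ) where

    f : List 𝕊 → Fin (2 ℕ.^ p) → Maybe (ℕ × ℤ)
    f A i = Maybe.map (ĥ q r)
      (minimum (map (λ a → h a * 2# ^ p - fromℕ (toℕ i))
                    (filter (λ a → inBucket? p i (h a)) A)))

    Z : List 𝕊 → List 𝕊 → Fin (2 ℕ.^ p) → ℕ
    Z A B i = collision (f A i) (f B i)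

    C : List 𝕊 → List 𝕊 → ℕ
    C A B = sumℕ (Z A B)

  collision≤1 : ∀ u v → collision u v ℕ.≤ 1
  collision≤1 nothing  _        = z≤n
  collision≤1 (just u) nothing  = z≤n
  collision≤1 (just u) (just v) with u ≟ᵛ v
  ... | yes _ = s≤s z≤n
  ... | no  _ = z≤n

  C≤2^p : ∀ {𝕊 : Set} (h : 𝕊 → ℝ) p q r A B → C h p q r A B ℕ.≤ 2 ℕ.^ p
  C≤2^p h p q r A B =
    sum≤ (λ i → collision≤1 (f h p q r A i) (f h p q r B i))
    where
    sum≤ : ∀ {n} {z : Vector ℕ n} → (∀ i → z i ℕ.≤ 1) → sumℕ z ℕ.≤ n
    sum≤ {zero}  _   = z≤n
    sum≤ {suc n} z≤1 = ℕₚ.+-mono-≤ (z≤1 Fin.zero) (sum≤ (z≤1 ∘ Fin.suc))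

module Submission where

-- Let γ = 1 - 2^-p.  Writing Zᵢ for the collision indicators, the variance is
-- 𝔼 C + Σ_{i≠j} ℙ(Zᵢ Zⱼ) - (𝔼 C)², and everything follows from
-- γ² ℙ(Zᵢ Zⱼ) ≤ ℙ(Zᵢ) ℙ(Zⱼ) for i ≠ j: by Cauchy–Schwarz the sum over i ≠ j is
-- then at most (𝔼 C)² / γ ≤ 2 (𝔼 C)².  The sketch of a bucket only depends on
-- which of finitely many ordered cells contains the minimum.  If the points
-- below a cell in bucket i have probability u and those below a cell in bucket
-- j have probability v, then all n hash values miss both with probability
-- (1 - u - v)^n, so that the probability of two given minima is a mixed second
-- difference of (x + z - 1)^n, whereas the two separate probabilities are
-- differences of x^n and of z^n, with x, z ∈ [γ, 1].  Comparing the mixed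
-- derivatives, γ n (n - 1) (x + z - 1)^(n - 2) ≤ n² (x z)^(n - 1), gives the
-- inequality for A and for B separately.

open import Defs
import Algebra.Definitions.RawMonoid as RawMonoidDefs
import Algebra.Properties.AbelianGroup as AbelianGroupProperties
import Algebra.Properties.CommutativeSemiring.Exp as CommutativeExp
import Algebra.Properties.Group as GroupProperties
open import Algebra.Properties.Monoid.Sum using (sum-init-last)
import Algebra.Properties.Ring as RingProperties
import Algebra.Properties.Semiring.Mult as Mult
import Algebra.Properties.Semiring.Sum as Sum
import Algebra.Solver.Ring as RingSolver
open import Algebra.Solver.Ring.AlmostCommutativeRing
  using (_-Raw-AlmostCommutative⟶_; fromCommutativeRing)
open import Data.Bool.Base using (if_then_else_)
open import Data.Empty using (⊥-elim)
open import Data.Fin.Base as Fin using (Fin; toℕ)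
import Data.Fin.Properties as Finₚ
open import Data.Integer.Base as ℤ using (ℤ; +_; -[1+_]; ∣_∣; _⊖_)
import Data.Integer.Properties as ℤₚ
open import Data.List.Base using (List; []; _∷_; _++_; map; filter; length; lookup)
import Data.List.Extrema as Extrema
open import Data.List.Membership.Propositional using () renaming (_∈_ to _∈ˡ_)
open import Data.List.Membership.Propositional.Properties
  using (∈-map⁺; ∈-map⁻; ∈-filter⁺; ∈-filter⁻; ∈-lookup)
open import Data.List.Relation.Binary.Disjoint.Propositional using (Disjoint)
open import Data.List.Relation.Unary.All as All using (All; []; _∷_)
import Data.List.Relation.Unary.All.Properties as Allₚ
open import Data.List.Relation.Unary.AllPairs using (AllPairs; []; _∷_)
import Data.List.Relation.Unary.AllPairs.Properties as AllPairsₚ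
open import Data.List.Relation.Unary.Any using (here; there)
open import Data.List.Relation.Unary.Unique.Propositional using (Unique)
open import Data.Maybe.Base using (Maybe; just; nothing; maybe)
open import Data.Nat.Base as ℕ using (ℕ; zero; suc; z≤n; s≤s; _>_)
import Data.Nat.Properties as ℕₚ
open import Data.Product.Base using (_×_; _,_; proj₁; proj₂; ∃; swap)
open import Data.Sum.Base using (_⊎_; inj₁; inj₂; [_,_])
open import Data.Unit.Base using (tt)
open import Data.Vec.Functional using (Vector)
open import Function.Base using (_∘_; id; _on_)
open import Function.Definitions using (Injective)
open import Level using (0ℓ)
open import Relation.Binary.Bundles using (DecTotalOrder)
open import Relation.Binary.Definitions using (WeaklyDecidable; tri<; tri≈; tri>)
open import Relation.Binary.PropositionalEquality as ≡ using (_≡_; _≢_)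
import Relation.Binary.Reasoning.PartialOrder as ≤-Reasoning
open import Relation.Nullary using (¬_; Dec; yes; no; does)
open import Relation.Nullary.Decidable using (¬?; _×-dec_; _⊎-dec_; decidable-stable)
open import Relation.Unary
  using (Pred; Decidable; U; ∅; ∁; ⋃; _≐_; _⊆_; _∈_; _∩_; _∪_; _⊢_)


-- The factor γ is forced by small sets: for n = 2 the comparison of mixed derivatives without it
-- would read 2 ≤ 4 x z, which fails at x = z = 1/2, while with it the two sides are equal at x = z
-- = γ = 1/2. It is spent once for `A` and once for `B`, whence γ². One of the two is regained
-- because the diagonal is absent from the sum over i ≠ j, and the other costs at most a factor 2,
-- since two distinct buckets force γ ≥ 1/2.
--
-- Instead of integrating the derivative inequality, rectangles are bisected: on a small rectangle
-- the inequality holds up to an error of third order, which repeated bisection removes.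
--
-- The endpoints of the cells are never computed. It suffices to number the hash codes so that the
-- number grows with the hash value: the part of a bucket below a given number is then an interval
-- starting at the left end of the bucket, and its supremum gives its probability.
--
-- Mean and variance are defined from the distribution of `C`, so linearity over the indicators has
-- to be recovered from the level sets of `C`.

module OrderedFieldProperties (F : OrderedField) where
  open OrderedField F
  open Mult semiring using (×-homo-+; ×1-homo-*)
  open Sum semiring public
    using (sum-cong-≋; ∑-distrib-+; ∑-comm; *-distribˡ-sum; *-distribʳ-sum; sum-replicate-zero)
  open RingProperties ring using (-‿distribˡ-*; -‿distribʳ-*)
  open GroupProperties +-group using () renaming (ε⁻¹≈ε to -0≈0; ⁻¹-involutive to -‿involutive)
  open AbelianGroupProperties +-abelianGroup using () renaming (⁻¹-∙-comm to -‿+-comm)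

  module ≤ = DecTotalOrder decTotalOrder
  module R≤ = ≤-Reasoning ≤.poset
  open import Relation.Binary.Reasoning.Setoid setoid

  -- Integers as coefficients of ring identities

  fromℤ-⊖ : ∀ m n → fromℤ (m ⊖ n) ≈ fromℕ m - fromℕ n
  fromℤ-⊖ zero    zero    = sym (-‿inverseʳ 0#)
  fromℤ-⊖ zero    (suc n) = sym (+-identityˡ _)
  fromℤ-⊖ (suc m) zero    = sym (trans (+-congˡ -0≈0) (+-identityʳ _))
  fromℤ-⊖ (suc m) (suc n) = begin
    fromℤ (suc m ⊖ suc n)                   ≡⟨ ≡.cong fromℤ (ℤₚ.[1+m]⊖[1+n]≡m⊖n m n) ⟩
    fromℤ (m ⊖ n)                           ≈⟨ fromℤ-⊖ m n ⟩
    fromℕ m - fromℕ n                       ≈⟨ +-congʳ (+-identityʳ _) ⟨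
    fromℕ m + 0# - fromℕ n                  ≈⟨ +-congʳ (+-congˡ (-‿inverseʳ 1#)) ⟨
    fromℕ m + (1# - 1#) - fromℕ n           ≈⟨ +-congʳ (+-assoc _ _ _) ⟨
    fromℕ m + 1# - 1# - fromℕ n             ≈⟨ +-assoc _ _ _ ⟩
    fromℕ m + 1# + (- 1# - fromℕ n)         ≈⟨ +-cong (+-comm _ _) (-‿+-comm _ _) ⟩
    fromℕ (suc m) - fromℕ (suc n)           ∎

  fromℤ-neg : ∀ i → fromℤ (ℤ.- i) ≈ - fromℤ i
  fromℤ-neg (+ zero)    = sym -0≈0
  fromℤ-neg (+ suc n)   = refl
  fromℤ-neg -[1+ n ]    = sym (-‿involutive _)

  fromℤ-+ : ∀ i j → fromℤ (i ℤ.+ j) ≈ fromℤ i + fromℤ j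
  fromℤ-+ (+ m)    (+ n)    = ×-homo-+ 1# m n
  fromℤ-+ (+ m)    -[1+ n ] = fromℤ-⊖ m (suc n)
  fromℤ-+ -[1+ m ] (+ n)    = trans (fromℤ-⊖ n (suc m)) (+-comm _ _)
  fromℤ-+ -[1+ m ] -[1+ n ] = begin
    - fromℕ (suc (suc (m ℕ.+ n)))          ≡⟨ ≡.cong (λ k → - fromℕ k) (ℕₚ.+-suc (suc m) n) ⟨
    - fromℕ (suc m ℕ.+ suc n)              ≈⟨ -‿cong (×-homo-+ 1# (suc m) (suc n)) ⟩
    - (fromℕ (suc m) + fromℕ (suc n))      ≈⟨ -‿+-comm _ _ ⟨
    - fromℕ (suc m) - fromℕ (suc n)        ∎

  private
    fromℤ-*₊ : ∀ m j → fromℤ (+ m ℤ.* j) ≈ fromℕ m * fromℤ j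
    fromℤ-*₊ m (+ n)    = begin
      fromℤ (+ m ℤ.* + n)  ≡⟨ ≡.cong fromℤ (ℤₚ.pos-* m n) ⟨
      fromℕ (m ℕ.* n)      ≈⟨ ×1-homo-* m n ⟩
      fromℕ m * fromℕ n    ∎
    fromℤ-*₊ m -[1+ n ] = begin
      fromℤ (+ m ℤ.* -[1+ n ])       ≡⟨ ≡.cong fromℤ (ℤₚ.neg-distribʳ-* (+ m) (+ suc n)) ⟨
      fromℤ (ℤ.- (+ m ℤ.* + suc n))  ≈⟨ fromℤ-neg (+ m ℤ.* + suc n) ⟩
      - fromℤ (+ m ℤ.* + suc n)      ≈⟨ -‿cong (fromℤ-*₊ m (+ suc n)) ⟩
      - (fromℕ m * fromℕ (suc n))    ≈⟨ -‿distribʳ-* _ _ ⟩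
      fromℕ m * - fromℕ (suc n)      ∎

  fromℤ-* : ∀ i j → fromℤ (i ℤ.* j) ≈ fromℤ i * fromℤ j
  fromℤ-* (+ m)    j = fromℤ-*₊ m j
  fromℤ-* -[1+ m ] j = begin
    fromℤ (-[1+ m ] ℤ.* j)       ≡⟨ ≡.cong fromℤ (ℤₚ.neg-distribˡ-* (+ suc m) j) ⟨
    fromℤ (ℤ.- (+ suc m ℤ.* j))  ≈⟨ fromℤ-neg (+ suc m ℤ.* j) ⟩
    - fromℤ (+ suc m ℤ.* j)      ≈⟨ -‿cong (fromℤ-*₊ (suc m) j) ⟩
    - (fromℕ (suc m) * fromℤ j)  ≈⟨ -‿distribˡ-* _ _ ⟩
    - fromℕ (suc m) * fromℤ j    ∎

  private
    -- Unlike fromℤ, this sends + 1 to 1# on the nose, so that the solver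
    -- recognises 1#.
    ⟦_⟧ : ℤ → ℝ
    ⟦ + 1 ⟧ = 1#
    ⟦ i ⟧   = fromℤ i

    ⟦⟧≈fromℤ : ∀ i → ⟦ i ⟧ ≈ fromℤ i
    ⟦⟧≈fromℤ (+ 0)           = refl
    ⟦⟧≈fromℤ (+ 1)           = sym (+-identityʳ 1#)
    ⟦⟧≈fromℤ (+ suc (suc _)) = refl
    ⟦⟧≈fromℤ -[1+ _ ]        = refl

    ℤ-morphism : ℤ.+-*-rawRing -Raw-AlmostCommutative⟶ fromCommutativeRing commutativeRing
    ℤ-morphism = record
      { ⟦_⟧    = ⟦_⟧
      ; +-homo = λ i j → trans (⟦⟧≈fromℤ (i ℤ.+ j)) (trans (fromℤ-+ i j)
                           (sym (+-cong (⟦⟧≈fromℤ i) (⟦⟧≈fromℤ j))))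
      ; *-homo = λ i j → trans (⟦⟧≈fromℤ (i ℤ.* j)) (trans (fromℤ-* i j)
                           (sym (*-cong (⟦⟧≈fromℤ i) (⟦⟧≈fromℤ j))))
      ; -‿homo = λ i → trans (⟦⟧≈fromℤ (ℤ.- i)) (trans (fromℤ-neg i)
                         (sym (-‿cong (⟦⟧≈fromℤ i))))
      ; 0-homo = refl
      ; 1-homo = refl
      }

    coeff≟ : WeaklyDecidable (λ i j → ⟦ i ⟧ ≈ ⟦ j ⟧)
    coeff≟ i j with i ℤₚ.≟ j
    ... | yes ≡.refl = just refl
    ... | no  _      = nothing

  open RingSolver ℤ.+-*-rawRing (fromCommutativeRing commutativeRing) ℤ-morphism coeff≟ public
    using (solve; con; _:=_; _:+_; _:*_; _:-_; :-_; _:^_)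

  -- Order arithmetic and finite sums in an ordered field

  infixr 2 _≤-by_

  -- The slack `e` is named explicitly, which reduces an inequality to the nonnegativity of an
  -- expression built from known slacks, together with a ring identity.
  _≤-by_ : ∀ {x y e} → 0# ≤ e → y ≈ x + e → x ≤ y
  _≤-by_ {x} {y} {e} 0≤e y≈x+e = R≤.begin
    x       R≤.≈⟨ +-identityʳ x ⟨
    x + 0#  R≤.≤⟨ +-monoʳ-≤ x 0≤e ⟩
    x + e   R≤.≈⟨ y≈x+e ⟨
    y       R≤.∎

  x≤y⇒0≤y-x : ∀ {x y} → x ≤ y → 0# ≤ y - x
  x≤y⇒0≤y-x {x} {y} x≤y = R≤.begin
    0#       R≤.≈⟨ -‿inverseˡ x ⟨
    - x + x  R≤.≤⟨ +-monoʳ-≤ (- x) x≤y ⟩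
    - x + y  R≤.≈⟨ +-comm _ _ ⟩
    y - x    R≤.∎

  +-nonneg : ∀ {x y} → 0# ≤ x → 0# ≤ y → 0# ≤ x + y
  +-nonneg {x} {y} 0≤x 0≤y = ≤.trans 0≤x (0≤y ≤-by refl)

  +-mono-≤ : ∀ {x y u v} → x ≤ y → u ≤ v → x + u ≤ y + v
  +-mono-≤ {x} {y} {u} {v} x≤y u≤v = +-nonneg (x≤y⇒0≤y-x x≤y) (x≤y⇒0≤y-x u≤v) ≤-by
    solve 4 (λ x y u v → y :+ v := x :+ u :+ (y :- x :+ (v :- u))) refl x y u v

  +-monoˡ-≤ : ∀ x {y z} → y ≤ z → y + x ≤ z + x
  +-monoˡ-≤ x y≤z = +-mono-≤ y≤z ≤.refl

  neg-mono-≤ : ∀ {x y} → x ≤ y → - y ≤ - x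
  neg-mono-≤ {x} {y} x≤y = x≤y⇒0≤y-x x≤y ≤-by
    solve 2 (λ x y → :- x := :- y :+ (y :- x)) refl x y

  *-monoˡ-≤ : ∀ {z x y} → 0# ≤ z → x ≤ y → z * x ≤ z * y
  *-monoˡ-≤ {z} {x} {y} 0≤z x≤y = *-nonneg 0≤z (x≤y⇒0≤y-x x≤y) ≤-by
    solve 3 (λ x y z → z :* y := z :* x :+ z :* (y :- x)) refl x y z

  *-monoʳ-≤ : ∀ {z x y} → 0# ≤ z → x ≤ y → x * z ≤ y * z
  *-monoʳ-≤ 0≤z x≤y =
    ≤.trans (≤.reflexive (*-comm _ _)) (≤.trans (*-monoˡ-≤ 0≤z x≤y) (≤.reflexive (*-comm _ _)))

  *-mono-≤ : ∀ {x y u v} → 0# ≤ x → 0# ≤ u → x ≤ y → u ≤ v → x * u ≤ y * v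
  *-mono-≤ 0≤x 0≤u x≤y u≤v =
    ≤.trans (*-monoʳ-≤ 0≤u x≤y) (*-monoˡ-≤ (≤.trans 0≤x x≤y) u≤v)

  ≰⇒> : ∀ {x y} → ¬ (x ≤ y) → y < x
  ≰⇒> {x} {y} x≰y with ≤.total x y
  ... | inj₁ x≤y = ⊥-elim (x≰y x≤y)
  ... | inj₂ y≤x = y≤x , λ y≈x → x≰y (≤.reflexive (sym y≈x))

  ≮⇒≥ : ∀ {x y} → ¬ (x < y) → y ≤ x
  ≮⇒≥ {x} {y} x≮y with y ≤? x
  ... | yes y≤x = y≤x
  ... | no  y≰x = ⊥-elim (x≮y (≰⇒> y≰x))

  <⇒≱ : ∀ {x y} → x < y → ¬ (y ≤ x)
  <⇒≱ (x≤y , x≉y) y≤x = x≉y (≤.antisym x≤y y≤x)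

  <-≤-trans : ∀ {x y z} → x < y → y ≤ z → x < z
  <-≤-trans (x≤y , x≉y) y≤z =
    ≤.trans x≤y y≤z , λ x≈z → x≉y (≤.antisym x≤y (≤.trans y≤z (≤.reflexive (sym x≈z))))

  ≤-<-trans : ∀ {x y z} → x ≤ y → y < z → x < z
  ≤-<-trans x≤y (y≤z , y≉z) =
    ≤.trans x≤y y≤z , λ x≈z → y≉z (≤.antisym y≤z (≤.trans (≤.reflexive (sym x≈z)) x≤y))

  x<y⇒0<y-x : ∀ {x y} → x < y → 0# < y - x
  x<y⇒0<y-x {x} {y} (x≤y , x≉y) = x≤y⇒0≤y-x x≤y , λ 0≈y-x → x≉y (begin
    x            ≈⟨ +-identityʳ x ⟨
    x + 0#       ≈⟨ +-congˡ 0≈y-x ⟩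
    x + (y - x)  ≈⟨ solve 2 (λ x y → x :+ (y :- x) := y) refl x y ⟩
    y            ∎)

  0<y-x⇒x<y : ∀ {x y} → 0# < y - x → x < y
  0<y-x⇒x<y {x} {y} 0<y-x = ≰⇒> λ y≤x → <⇒≱ 0<y-x (x≤y⇒0≤y-x y≤x ≤-by
    solve 2 (λ x y → con (+ 0) := y :- x :+ (x :- y)) refl x y)

  0≤x² : ∀ x → 0# ≤ x * x
  0≤x² x with ≤.total 0# x
  ... | inj₁ 0≤x = *-nonneg 0≤x 0≤x
  ... | inj₂ x≤0 = ≤.trans (*-nonneg 0≤-x 0≤-x)
                     (≤.reflexive (solve 1 (λ x → :- x :* :- x := x :* x) refl x))
    where
    0≤-x : 0# ≤ - x
    0≤-x = ≤.trans (≤.reflexive (sym -0≈0)) (neg-mono-≤ x≤0)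

  0≤1 : 0# ≤ 1#
  0≤1 = ≤.trans (0≤x² 1#) (≤.reflexive (*-identityˡ 1#))

  0<1 : 0# < 1#
  0<1 = 0≤1 , 0≉1

  0≤fromℕ : ∀ n → 0# ≤ fromℕ n
  0≤fromℕ zero    = ≤.refl
  0≤fromℕ (suc n) = +-nonneg 0≤1 (0≤fromℕ n)

  fromℕ-mono-≤ : ∀ {m n} → m ℕ.≤ n → fromℕ m ≤ fromℕ n
  fromℕ-mono-≤ {n = n} z≤n = 0≤fromℕ n
  fromℕ-mono-≤ (s≤s m≤n)   = +-monoʳ-≤ 1# (fromℕ-mono-≤ m≤n)

  fromℕ-mono-< : ∀ {m n} → m ℕ.< n → fromℕ m < fromℕ n
  fromℕ-mono-< {m} {n} m<n = <-≤-trans (m≤1+m , m≉1+m) (fromℕ-mono-≤ m<n)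
    where
    m≤1+m : fromℕ m ≤ 1# + fromℕ m
    m≤1+m = 0≤1 ≤-by +-comm _ _
    m≉1+m : ¬ (fromℕ m ≈ 1# + fromℕ m)
    m≉1+m m≈1+m = 0≉1 (begin
      0#                       ≈⟨ -‿inverseʳ _ ⟨
      fromℕ m - fromℕ m        ≈⟨ +-congʳ m≈1+m ⟩
      1# + fromℕ m - fromℕ m   ≈⟨ solve 1 (λ m → con (+ 1) :+ m :- m := con (+ 1)) refl (fromℕ m) ⟩
      1#                       ∎)

  0<fromℕ : ∀ n → 0# < fromℕ (suc n)
  0<fromℕ n = fromℕ-mono-< {0} {suc n} (s≤s z≤n)

  fromℕ-cancel-< : ∀ {m n} → fromℕ m < fromℕ n → m ℕ.< n
  fromℕ-cancel-< m<n = ℕₚ.≰⇒> (λ n≤m → <⇒≱ m<n (fromℕ-mono-≤ n≤m))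

  *-cancel-0 : ∀ {x y} → 0# < x → x * y ≈ 0# → y ≈ 0#
  *-cancel-0 {x} {y} (0≤x , 0≉x) xy≈0 = begin
    y                 ≈⟨ *-identityˡ y ⟨
    1# * y            ≈⟨ *-congʳ (*-inverseʳ x (0≉x ∘ sym)) ⟨
    x * x ⁻¹ * y      ≈⟨ solve 3 (λ x i y → x :* i :* y := i :* (x :* y)) refl x (x ⁻¹) y ⟩
    x ⁻¹ * (x * y)    ≈⟨ *-congˡ xy≈0 ⟩
    x ⁻¹ * 0#         ≈⟨ zeroʳ _ ⟩
    0#                ∎

  *-cancel-nonneg : ∀ {x y} → 0# < x → 0# ≤ x * y → 0# ≤ y
  *-cancel-nonneg {x} {y} 0<x 0≤xy with ≤.total 0# y
  ... | inj₁ 0≤y = 0≤y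
  ... | inj₂ y≤0 = ≤.reflexive (sym (*-cancel-0 0<x (≤.antisym xy≤0 0≤xy)))
    where
    xy≤0 : x * y ≤ 0#
    xy≤0 = ≤.trans (*-monoˡ-≤ (proj₁ 0<x) y≤0) (≤.reflexive (zeroʳ x))

  *-cancel-≤ : ∀ {x y z} → 0# < x → x * y ≤ x * z → y ≤ z
  *-cancel-≤ {x} {y} {z} 0<x xy≤xz =
    *-cancel-nonneg 0<x (≤.trans (x≤y⇒0≤y-x xy≤xz)
      (≤.reflexive (solve 3 (λ x y z → x :* z :- x :* y := x :* (z :- y)) refl x y z)))
    ≤-by solve 2 (λ y z → z := y :+ (z :- y)) refl y z

  *-pos : ∀ {x y} → 0# < x → 0# < y → 0# < x * y
  *-pos 0<x (0≤y , 0≉y) =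
    *-nonneg (proj₁ 0<x) 0≤y , λ 0≈xy → 0≉y (sym (*-cancel-0 0<x (sym 0≈xy)))

  *-mono-< : ∀ {z x y} → 0# < z → x < y → z * x < z * y
  *-mono-< {z} {x} {y} 0<z x<y = 0<y-x⇒x<y (<-≤-trans (*-pos 0<z (x<y⇒0<y-x x<y))
    (≤.reflexive (solve 3 (λ x y z → z :* (y :- x) := z :* y :- z :* x) refl x y z)))

  ⁻¹-inverseʳ : ∀ {x} → 0# < x → x * x ⁻¹ ≈ 1#
  ⁻¹-inverseʳ {x} (_ , 0≉x) = *-inverseʳ x (0≉x ∘ sym)

  ⁻¹-nonneg : ∀ {x} → 0# < x → 0# ≤ x ⁻¹
  ⁻¹-nonneg 0<x = *-cancel-nonneg 0<x (≤.trans 0≤1 (≤.reflexive (sym (⁻¹-inverseʳ 0<x))))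

  ⁻¹-pos : ∀ {x} → 0# < x → 0# < x ⁻¹
  ⁻¹-pos {x} 0<x = ⁻¹-nonneg 0<x , λ 0≈1/x → 0≉1 (begin
    0#          ≈⟨ zeroʳ _ ⟨
    x * 0#      ≈⟨ *-congˡ 0≈1/x ⟩
    x * x ⁻¹    ≈⟨ ⁻¹-inverseʳ 0<x ⟩
    1#          ∎)

  ^-nonneg : ∀ {x} n → 0# ≤ x → 0# ≤ x ^ n
  ^-nonneg zero    0≤x = 0≤1
  ^-nonneg (suc n) 0≤x = *-nonneg 0≤x (^-nonneg n 0≤x)

  ^-pos : ∀ {x} n → 0# < x → 0# < x ^ n
  ^-pos zero    0<x = 0<1
  ^-pos (suc n) 0<x = *-pos 0<x (^-pos n 0<x)

  ^-mono-≤ : ∀ {x y} n → 0# ≤ x → x ≤ y → x ^ n ≤ y ^ n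
  ^-mono-≤ zero    0≤x x≤y = ≤.refl
  ^-mono-≤ (suc n) 0≤x x≤y = *-mono-≤ 0≤x (^-nonneg n 0≤x) x≤y (^-mono-≤ n 0≤x x≤y)

  ^-≤1 : ∀ {x} n → 0# ≤ x → x ≤ 1# → x ^ n ≤ 1#
  ^-≤1 zero    0≤x x≤1 = ≤.refl
  ^-≤1 (suc n) 0≤x x≤1 =
    ≤.trans (*-mono-≤ 0≤x (^-nonneg n 0≤x) x≤1 (^-≤1 n 0≤x x≤1)) (≤.reflexive (*-identityˡ 1#))

  0<2 : 0# < 2#
  0<2 = 0<fromℕ 1

  fromℕ-2^ : ∀ n → fromℕ (2 ℕ.^ n) ≈ 2# ^ n
  fromℕ-2^ zero    = +-identityʳ 1#
  fromℕ-2^ (suc n) = trans (×1-homo-* 2 (2 ℕ.^ n)) (*-congˡ (fromℕ-2^ n))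

  sum-mono-≤ : ∀ {n} {s t : Vector ℝ n} → (∀ i → s i ≤ t i) → sum s ≤ sum t
  sum-mono-≤ {zero}  s≤t = ≤.refl
  sum-mono-≤ {suc n} s≤t = +-mono-≤ (s≤t Fin.zero) (sum-mono-≤ (s≤t ∘ Fin.suc))

  sum-nonneg : ∀ {n} {t : Vector ℝ n} → (∀ i → 0# ≤ t i) → 0# ≤ sum t
  sum-nonneg {n} 0≤t = ≤.trans (≤.reflexive (sym (sum-replicate-zero n))) (sum-mono-≤ 0≤t)

  sum-const : ∀ n x → sum {n} (λ _ → x) ≈ fromℕ n * x
  sum-const zero    x = sym (zeroˡ x)
  sum-const (suc n) x = begin
    x + sum {n} (λ _ → x)   ≈⟨ +-cong (sym (*-identityˡ x)) (sum-const n x) ⟩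
    1# * x + fromℕ n * x    ≈⟨ distribʳ x 1# (fromℕ n) ⟨
    fromℕ (suc n) * x       ∎

-- Powers and their mixed differences

module PowerInequalities (R : Reals) where
  open Reals R
  open OrderedFieldProperties orderedField
  open CommutativeExp commutativeSemiring using (^-distrib-*)
  open import Relation.Binary.Reasoning.Setoid setoid

  fromℤ≤fromℕ∣∣ : ∀ i → fromℤ i ≤ fromℕ ∣ i ∣
  fromℤ≤fromℕ∣∣ (+ n)    = ≤.refl
  fromℤ≤fromℕ∣∣ -[1+ n ] = +-nonneg (0≤fromℕ (suc n)) (0≤fromℕ (suc n)) ≤-by
    solve 1 (λ n → n := :- n :+ (n :+ n)) refl (fromℕ (suc n))

  archimedean : ∀ x → ∃ λ n → x < fromℕ n
  archimedean x = suc ∣ ⌊ x ⌋ ∣ , <-≤-trans (⌊⌋-upper x)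
    (≤.trans (+-monoˡ-≤ 1# (fromℤ≤fromℕ∣∣ ⌊ x ⌋)) (≤.reflexive (+-comm _ _)))

  bounded-multiples⇒≤0 : ∀ {x b} → (∀ n → fromℕ n * x ≤ b) → x ≤ 0#
  bounded-multiples⇒≤0 {x} {b} nx≤b with x ≤? 0#
  ... | yes x≤0 = x≤0
  ... | no  x≰0 with archimedean (b * x ⁻¹)
  ...   | n , b/x<n = ⊥-elim (<⇒≱ b/x<n (≤.trans (≤.reflexive n≈nx/x)
            (*-monoʳ-≤ (⁻¹-nonneg 0<x) (nx≤b n))))
    where
    0<x : 0# < x
    0<x = ≰⇒> x≰0
    n≈nx/x : fromℕ n ≈ fromℕ n * x * x ⁻¹
    n≈nx/x = sym (trans (*-assoc _ _ _) (trans (*-congˡ (⁻¹-inverseʳ 0<x)) (*-identityʳ _)))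

  -- Plays the role of letting an error b / 2^n tend to zero; 2^n ≥ n reduces it to the archimedean
  -- property.
  bounded-doublings⇒≤0 : ∀ {x b} → (∀ n → 2# ^ n * x ≤ b) → x ≤ 0#
  bounded-doublings⇒≤0 {x} {b} 2^nx≤b with ≤.total x 0#
  ... | inj₁ x≤0 = x≤0
  ... | inj₂ 0≤x = bounded-multiples⇒≤0 λ n → ≤.trans (*-monoʳ-≤ 0≤x
          (≤.trans (fromℕ-mono-≤ (n≤2^n n)) (≤.reflexive (fromℕ-2^ n)))) (2^nx≤b n)
    where
    n≤2^n : ∀ n → n ℕ.≤ 2 ℕ.^ n
    n≤2^n zero    = z≤n
    n≤2^n (suc n) = ℕₚ.≤-trans (ℕₚ.+-mono-≤ (ℕₚ.m^n>0 2 n) (n≤2^n n))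
      (ℕₚ.≤-reflexive (≡.cong (2 ℕ.^ n ℕ.+_) (≡.sym (ℕₚ.+-identityʳ _))))

  half : ℝ
  half = 2# ⁻¹

  2half≈1 : 2# * half ≈ 1#
  2half≈1 = ⁻¹-inverseʳ 0<2

  mid : ℝ → ℝ → ℝ
  mid x y = (x + y) * half

  x≈2halfx : ∀ x → x ≈ 2# * half * x
  x≈2halfx x = sym (trans (*-congʳ 2half≈1) (*-identityˡ x))

  upper-half : ∀ x y → x - mid x y ≈ half * (x - y)
  upper-half x y = trans (+-congʳ (x≈2halfx x))
    (solve 3 (λ c x y → con (+ 2) :* c :* x :- (x :+ y) :* c := c :* (x :- y)) refl half x y)

  lower-half : ∀ x y → mid x y - y ≈ half * (x - y)
  lower-half x y = trans (+-congˡ (-‿cong (x≈2halfx y)))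
    (solve 3 (λ c x y → (x :+ y) :* c :- con (+ 2) :* c :* y := c :* (x :- y)) refl half x y)

  mid≤ : ∀ {x y} → y ≤ x → mid x y ≤ x
  mid≤ {x} {y} y≤x = *-nonneg (⁻¹-nonneg 0<2) (x≤y⇒0≤y-x y≤x) ≤-by
    trans (solve 2 (λ x m → x := m :+ (x :- m)) refl x (mid x y)) (+-congˡ (upper-half x y))

  ≤mid : ∀ {x y} → y ≤ x → y ≤ mid x y
  ≤mid {x} {y} y≤x = *-nonneg (⁻¹-nonneg 0<2) (x≤y⇒0≤y-x y≤x) ≤-by
    trans (solve 2 (λ y m → m := y :+ (m :- y)) refl y (mid x y)) (+-congˡ (lower-half x y))

  <mid : ∀ {x y} → y < x → y < mid x y
  <mid {x} {y} y<x = 0<y-x⇒x<y (<-≤-trans (*-pos (⁻¹-pos 0<2) (x<y⇒0<y-x y<x))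
    (≤.reflexive (sym (lower-half x y))))

  mid< : ∀ {x y} → y < x → mid x y < x
  mid< {x} {y} y<x = 0<y-x⇒x<y (<-≤-trans (*-pos (⁻¹-pos 0<2) (x<y⇒0<y-x y<x))
    (≤.reflexive (sym (upper-half x y))))

  -- The mixed second difference over the rectangle [y,x] × [t,z]; for smooth `F` it is the integral
  -- of the mixed derivative.
  □ : (ℝ → ℝ → ℝ) → ℝ → ℝ → ℝ → ℝ → ℝ
  □ F x y z t = F x z - F y z - F x t + F y t

  module _ (F : ℝ → ℝ → ℝ) (lo hi K : ℝ) where
    private
      -- One order higher than the area `h * k`, so that the total over ever finer subdivisions
      -- vanishes.
      bound : ℝ → ℝ → ℝ
      bound h k = K * (h * k * (h + k))

      bound-cong : ∀ {h h′ k k′} → h ≈ h′ → k ≈ k′ → bound h k ≈ bound h′ k′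
      bound-cong h≈ k≈ = *-congˡ (*-cong (*-cong h≈ k≈) (+-cong h≈ k≈))

      OnRectangles : (ℝ → ℝ → ℝ → ℝ → Set) → Set
      OnRectangles P = ∀ x y z t → lo ≤ y → y ≤ x → x ≤ hi → lo ≤ t → t ≤ z → z ≤ hi → P x y z t

    -- Cutting a rectangle into four halves the total error, so an error of
    -- third order in the side lengths must vanish.
    □-nonneg : OnRectangles (λ x y z t → - □ F x y z t ≤ bound (x - y) (z - t)) →
               OnRectangles (λ x y z t → 0# ≤ □ F x y z t)
    □-nonneg local x y z t lo≤y y≤x x≤hi lo≤t t≤z z≤hi =
      ≤.trans (x≤y⇒0≤y-x (bounded-doublings⇒≤0 λ n → refined n x y z t lo≤y y≤x x≤hi lo≤t t≤z z≤hi))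
        (≤.reflexive (solve 1 (λ d → con (+ 0) :- :- d := d) refl (□ F x y z t)))
      where
      refined : ∀ n → OnRectangles (λ x y z t → 2# ^ n * - □ F x y z t ≤ bound (x - y) (z - t))
      refined zero x y z t p q r p′ q′ r′ =
        ≤.trans (≤.reflexive (*-identityˡ _)) (local x y z t p q r p′ q′ r′)
      refined (suc n) x y z t lo≤y y≤x x≤hi lo≤t t≤z z≤hi = R≤.begin
        2# ^ suc n * - □ F x y z t
          -- Mixed differences add up over the four quarters cut at `m` and `l`.
          R≤.≈⟨ solve 10 (λ e a₁ a₂ a₃ b₁ b₂ b₃ c₁ c₂ c₃ →
                  con (+ 2) :* e :* (:- (a₁ :- c₁ :- a₃ :+ c₃)) :=
                  con (+ 2) :* (e :* (:- (a₁ :- b₁ :- a₂ :+ b₂)) :+ e :* (:- (a₂ :- b₂ :- a₃ :+ b₃))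
                            :+ (e :* (:- (b₁ :- c₁ :- b₂ :+ c₂)) :+ e :* (:- (b₂ :- c₂ :- b₃ :+ c₃)))))
                refl (2# ^ n) (F x z) (F x l) (F x t) (F m z) (F m l) (F m t) (F y z) (F y l) (F y t) ⟩
        2# * (2# ^ n * - □ F x m z l + 2# ^ n * - □ F x m l t
            + (2# ^ n * - □ F m y z l + 2# ^ n * - □ F m y l t))
          R≤.≤⟨ *-monoˡ-≤ (proj₁ 0<2) (+-mono-≤
                  (+-mono-≤ (refined n x m z l lo≤m m≤x x≤hi lo≤l l≤z z≤hi)
                            (refined n x m l t lo≤m m≤x x≤hi lo≤t t≤l l≤hi))
                  (+-mono-≤ (refined n m y z l lo≤y y≤m m≤hi lo≤l l≤z z≤hi)
                            (refined n m y l t lo≤y y≤m m≤hi lo≤t t≤l l≤hi))) ⟩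
        2# * (bound (x - m) (z - l) + bound (x - m) (l - t) + (bound (m - y) (z - l) + bound (m - y) (l - t)))
          R≤.≈⟨ *-congˡ (+-cong
                  (+-cong (bound-cong (upper-half x y) (upper-half z t))
                          (bound-cong (upper-half x y) (lower-half z t)))
                  (+-cong (bound-cong (lower-half x y) (upper-half z t))
                          (bound-cong (lower-half x y) (lower-half z t)))) ⟩
        -- All three factors of `bound` halve, so each quarter carries an eighth of it; four
        -- quarters and the factor 2 from `2# ^ suc n` restore it exactly.
        2# * (B + B + (B + B))
          R≤.≈⟨ solve 4 (λ K c h k → let b = K :* (c :* h :* (c :* k) :* (c :* h :+ c :* k)) in
                  con (+ 2) :* (b :+ b :+ (b :+ b)) :=
                  con (+ 2) :* c :* (con (+ 2) :* c :* (con (+ 2) :* c :* (K :* (h :* k :* (h :+ k))))))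
                refl K half (x - y) (z - t) ⟩
        2# * half * (2# * half * (2# * half * bound (x - y) (z - t)))
          R≤.≈⟨ trans (x≈2halfx _) (trans (*-congˡ (x≈2halfx _)) (*-congˡ (*-congˡ (x≈2halfx _)))) ⟨
        bound (x - y) (z - t)  R≤.∎
        where
        m l B : ℝ
        m = mid x y
        l = mid z t
        B = bound (half * (x - y)) (half * (z - t))
        m≤x = mid≤ y≤x
        y≤m = ≤mid y≤x
        l≤z = mid≤ t≤z
        t≤l = ≤mid t≤z
        lo≤m = ≤.trans lo≤y y≤m
        lo≤l = ≤.trans lo≤t t≤l
        m≤hi = ≤.trans m≤x x≤hi
        l≤hi = ≤.trans l≤z z≤hi

  -- Convexity: the secant is at least as steep as the tangent at the left endpoint and, in
  -- `^-diff-≤`, at most as steep as the one at the right. The pair replaces the mean value theorem.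
  ^-diff-≥ : ∀ n {x y} → 0# ≤ y → y ≤ x → fromℕ (suc n) * (x - y) * y ^ n ≤ x ^ suc n - y ^ suc n
  ^-diff-≥ zero {x} {y} 0≤y y≤x = ≤.reflexive
    (solve 2 (λ x y → (con (+ 1) :+ con (+ 0)) :* (x :- y) :* con (+ 1) := x :* con (+ 1) :- y :* con (+ 1)) refl x y)
  ^-diff-≥ (suc n) {x} {y} 0≤y y≤x =
    +-nonneg (*-nonneg (≤.trans 0≤y y≤x) (x≤y⇒0≤y-x (^-diff-≥ n 0≤y y≤x)))
      (*-nonneg 0≤h (*-nonneg (*-nonneg (0≤fromℕ (suc n)) 0≤h) (^-nonneg n 0≤y))) ≤-by
    solve 5 (λ N x y X Y →
      x :* (x :* X) :- y :* (y :* Y) :=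
      (con (+ 1) :+ N) :* (x :- y) :* (y :* Y) :+
        (x :* (x :* X :- y :* Y :- N :* (x :- y) :* Y) :+ (x :- y) :* (N :* (x :- y) :* Y)))
      refl (fromℕ (suc n)) x y (x ^ n) (y ^ n)
    where
    0≤h = x≤y⇒0≤y-x y≤x

  ^-diff-≤ : ∀ n {x y} → 0# ≤ y → y ≤ x → x ^ suc n - y ^ suc n ≤ fromℕ (suc n) * (x - y) * x ^ n
  ^-diff-≤ zero {x} {y} 0≤y y≤x = ≤.reflexive
    (solve 2 (λ x y → x :* con (+ 1) :- y :* con (+ 1) := (con (+ 1) :+ con (+ 0)) :* (x :- y) :* con (+ 1)) refl x y)
  ^-diff-≤ (suc n) {x} {y} 0≤y y≤x =
    +-nonneg (*-nonneg 0≤y (x≤y⇒0≤y-x (^-diff-≤ n 0≤y y≤x)))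
      (*-nonneg 0≤h (*-nonneg (*-nonneg (0≤fromℕ (suc n)) 0≤h) (^-nonneg n (≤.trans 0≤y y≤x)))) ≤-by
    solve 5 (λ N x y X Y →
      (con (+ 1) :+ N) :* (x :- y) :* (x :* X) :=
      x :* (x :* X) :- y :* (y :* Y) :+
        (y :* (N :* (x :- y) :* X :- (x :* X :- y :* Y)) :+ (x :- y) :* (N :* (x :- y) :* X)))
      refl (fromℕ (suc n)) x y (x ^ n) (y ^ n)
    where
    0≤h = x≤y⇒0≤y-x y≤x

  -- The probability of missing two disjoint sets that are missed with
  -- probabilities x and z respectively.
  w : ℝ → ℝ → ℝ
  w x z = x + z - 1#

  module _ {x y z t : ℝ} (0≤w : 0# ≤ w y t) (y≤x : y ≤ x) (t≤z : t ≤ z) where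
    private
      h = x - y
      k = z - t
      0≤h = x≤y⇒0≤y-x y≤x
      0≤k = x≤y⇒0≤y-x t≤z

      wyt≤wxt : w y t ≤ w x t
      wyt≤wxt = +-monoˡ-≤ _ (+-monoˡ-≤ t y≤x)
      wyt≤wyz : w y t ≤ w y z
      wyt≤wyz = +-monoˡ-≤ _ (+-monoʳ-≤ y t≤z)
      wyz≤wxz : w y z ≤ w x z
      wyz≤wxz = +-monoˡ-≤ _ (+-monoˡ-≤ z y≤x)
      wxt≤wxz : w x t ≤ w x z
      wxt≤wxz = +-monoˡ-≤ _ (+-monoʳ-≤ x t≤z)
      0≤wxt = ≤.trans 0≤w wyt≤wxt
      0≤wyz = ≤.trans 0≤w wyt≤wyz

      □^ : ℕ → ℝ
      □^ n = □ (λ x z → w x z ^ n) x y z t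

      -- A discrete product rule. Since `w` is affine without a mixed term, each correction has one
      -- factor varying in one coordinate and the other factor in the other.
      □^-suc : ∀ n → □^ (suc n) ≈ w y t * □^ n
                 + (h * (w x z ^ n - w x t ^ n) + k * (w x z ^ n - w y z ^ n))
      □^-suc n = solve 8 (λ x y z t a b c d →
        (x :+ z :- con (+ 1)) :* a :- (y :+ z :- con (+ 1)) :* b :- (x :+ t :- con (+ 1)) :* c :+ (y :+ t :- con (+ 1)) :* d :=
        (y :+ t :- con (+ 1)) :* (a :- b :- c :+ d) :+ ((x :- y) :* (a :- c) :+ (z :- t) :* (a :- b)))
        refl x y z t (w x z ^ n) (w y z ^ n) (w x t ^ n) (w y t ^ n)

    □-w^-nonneg : ∀ n → 0# ≤ □^ n
    □-w^-nonneg zero    = ≤.reflexive (solve 0 (con (+ 0) := con (+ 1) :- con (+ 1) :- con (+ 1) :+ con (+ 1)) refl)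
    □-w^-nonneg (suc n) = ≤.trans
      (+-nonneg (*-nonneg 0≤w (□-w^-nonneg n))
        (+-nonneg (*-nonneg 0≤h (x≤y⇒0≤y-x (^-mono-≤ n 0≤wxt wxt≤wxz)))
                  (*-nonneg 0≤k (x≤y⇒0≤y-x (^-mono-≤ n 0≤wyz wyz≤wxz)))))
      (≤.reflexive (sym (□^-suc n)))

    -- Area times the largest value of the mixed derivative of the power of `w`, which is attained
    -- at the upper corner (x,z).
    □-w^-≤ : ∀ n → □^ (suc (suc n)) ≤ fromℕ (suc n) * fromℕ (suc (suc n)) * (h * k) * w x z ^ n
    □-w^-≤ zero = ≤.reflexive (solve 4 (λ x y z t →
      let p = x :+ z :- con (+ 1)
          q = y :+ z :- con (+ 1)
          r = x :+ t :- con (+ 1)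
          s = y :+ t :- con (+ 1)
      in
      p :* (p :* con (+ 1)) :- q :* (q :* con (+ 1)) :- r :* (r :* con (+ 1)) :+ s :* (s :* con (+ 1)) :=
      (con (+ 1) :+ con (+ 0)) :* con (+ 2) :* ((x :- y) :* (z :- t)) :* con (+ 1)) refl x y z t)
    □-w^-≤ (suc n) = R≤.begin
      □^ (suc (suc (suc n)))
        R≤.≈⟨ □^-suc (suc (suc n)) ⟩
      w y t * □^ (suc (suc n))
        + (h * (w x z ^ suc (suc n) - w x t ^ suc (suc n)) + k * (w x z ^ suc (suc n) - w y z ^ suc (suc n)))
        R≤.≤⟨ +-mono-≤
                (*-mono-≤ 0≤w (□-w^-nonneg (suc (suc n))) (≤.trans wyt≤wxt wxt≤wxz) (□-w^-≤ n))
                (+-mono-≤ (*-monoˡ-≤ 0≤h (^-diff-≤ (suc n) 0≤wxt wxt≤wxz))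
                          (*-monoˡ-≤ 0≤k (^-diff-≤ (suc n) 0≤wyz wyz≤wxz))) ⟩
      w x z * (fromℕ (suc n) * fromℕ (suc (suc n)) * (h * k) * w x z ^ n)
        + (h * (fromℕ (suc (suc n)) * (w x z - w x t) * w x z ^ suc n)
          + k * (fromℕ (suc (suc n)) * (w x z - w y z) * w x z ^ suc n))
        R≤.≈⟨ solve 6 (λ N x y z t a →
                let p = x :+ z :- con (+ 1)
                    q = y :+ z :- con (+ 1)
                    r = x :+ t :- con (+ 1)
                    1+N = con (+ 1) :+ N
                in
                p :* (N :* 1+N :* ((x :- y) :* (z :- t)) :* a)
                  :+ ((x :- y) :* (1+N :* (p :- r) :* (p :* a)) :+ (z :- t) :* (1+N :* (p :- q) :* (p :* a))) :=
                1+N :* (con (+ 1) :+ 1+N) :* ((x :- y) :* (z :- t)) :* (p :* a))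
              refl (fromℕ (suc n)) x y z t (w x z ^ n) ⟩
      fromℕ (suc (suc n)) * fromℕ (suc (suc (suc n))) * (h * k) * w x z ^ suc n  R≤.∎

  -- The sign of the slope decides which endpoint of [0,β] bounds the value from below.
  affine-nonneg : ∀ {α δ u β} → 0# ≤ α → 0# ≤ α + δ * β → 0# ≤ u → u ≤ β → 0# ≤ α + δ * u
  affine-nonneg {α} {δ} {u} {β} 0≤α 0≤α+δβ 0≤u u≤β with ≤.total 0# δ
  ... | inj₁ 0≤δ = +-nonneg 0≤α (*-nonneg 0≤δ 0≤u)
  ... | inj₂ δ≤0 = ≤.trans 0≤α+δβ (*-nonneg (x≤y⇒0≤y-x δ≤0) (x≤y⇒0≤y-x u≤β) ≤-by
    solve 4 (λ α δ u β → α :+ δ :* u := α :+ δ :* β :+ (con (+ 0) :- δ) :* (β :- u)) refl α δ u β)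

  module _ {γ : ℝ} (1≤2γ : 1# ≤ 2# * γ) (γ≤1 : γ ≤ 1#) where
    private
      β = 1# - γ
      0≤β : 0# ≤ β
      0≤β = x≤y⇒0≤y-x γ≤1
      0≤γ : 0# ≤ γ
      0≤γ = *-cancel-nonneg 0<2 (≤.trans 0≤1 1≤2γ)

      -- The value at the critical corner y = t = γ in `coefficient-≥`. As a quadratic in β it has
      -- real roots only for n = 0, namely 1/2 and 1; that case rests on γ ≥ 1/2.
      corner : ∀ n → let ν = fromℕ n in
        0# ≤ 1# - (fromℕ 3 + ν) * β + (2# + ν) * (1# + ν) * (β * β)
      corner zero = ≤.trans (*-nonneg 0≤γ (x≤y⇒0≤y-x 1≤2γ)) (≤.reflexive
        (solve 1 (λ γ → let β = con (+ 1) :- γ in γ :* (con (+ 2) :* γ :- con (+ 1)) :=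
          con (+ 1) :- (con (+ 3) :+ con (+ 0)) :* β
            :+ (con (+ 2) :+ con (+ 0)) :* (con (+ 1) :+ con (+ 0)) :* (β :* β)) refl γ))
      -- Four times the expression with the square in β completed; `0<fromℕ 3` says that 4 is
      -- positive. The coefficient left over is 3ν² + 12ν + 8.
      corner (suc n) = *-cancel-nonneg (0<fromℕ 3) (≤.trans
        (+-nonneg (0≤x² (2# - (fromℕ 4 + ν) * β))
          (*-nonneg (+-nonneg (*-nonneg (0≤fromℕ 3) (0≤x² ν))
                              (+-nonneg (*-nonneg (0≤fromℕ 12) (0≤fromℕ n)) (0≤fromℕ 8)))
                    (0≤x² β)))
        (≤.reflexive (solve 2 (λ ν β → let e = con (+ 2) :- (con (+ 4) :+ ν) :* β in
          e :* e :+ (con (+ 3) :* (ν :* ν) :+ (con (+ 12) :* ν :+ con (+ 8))) :* (β :* β) :=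
          con (+ 4) :* (con (+ 1) :- (con (+ 3) :+ (con (+ 1) :+ ν)) :* β
            :+ (con (+ 2) :+ (con (+ 1) :+ ν)) :* (con (+ 1) :+ (con (+ 1) :+ ν)) :* (β :* β)))
          refl ν β)))
        where ν = fromℕ n

      -- The difference of the two sides is affine in y and in t, so it suffices
      -- to look at the corners of the square [γ,1]².
      coefficient-≥ : ∀ n {y t} → γ ≤ y → y ≤ 1# → γ ≤ t → t ≤ 1# →
        γ * fromℕ (suc n) ≤ fromℕ (suc (suc n)) * (w y t + fromℕ (suc n) * (y * t - w y t))
      coefficient-≥ n {y} {t} γ≤y y≤1 γ≤t t≤1 =
        -- With u = 1 - y and v = 1 - t one has y t - w = u v, so the difference of the two sides is
        -- α₀ + δ₀ (u + v) + ε u v. The nested uses treat the edges u = 0 and u = β.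
        affine-nonneg {α₀ + δ₀ * v} {δ₀ + ε * v} {u} {β}
          (affine-nonneg {α₀} {δ₀} {v} {β} 0≤α₀ 0≤γ′ 0≤v v≤β)
          (≤.trans (affine-nonneg {α₀ + δ₀ * β} {δ₀ + ε * β} {v} {β} 0≤γ′
                      (≤.trans (corner n) (≤.reflexive (solve 2 (λ ν γ → let β = con (+ 1) :- γ in
                        con (+ 1) :- (con (+ 3) :+ ν) :* β :+ (con (+ 2) :+ ν) :* (con (+ 1) :+ ν) :* (β :* β) :=
                        con (+ 1) :+ (con (+ 1) :+ ν) :* β :+ (:- (con (+ 2) :+ ν)) :* β
                        :+ ((:- (con (+ 2) :+ ν)) :+ (con (+ 2) :+ ν) :* (con (+ 1) :+ ν) :* β) :* β) refl ν γ)))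
                      0≤v v≤β)
            (≤.reflexive (solve 5 (λ a d e v b → a :+ d :* b :+ (d :+ e :* b) :* v :=
                                     a :+ d :* v :+ (d :+ e :* v) :* b) refl α₀ δ₀ ε v β)))
          0≤u u≤β
        ≤-by solve 4 (λ ν γ y t →
          let N = con (+ 1) :+ ν
              u = con (+ 1) :- y
              v = con (+ 1) :- t
              w = y :+ t :- con (+ 1)
              δ = :- (con (+ 2) :+ ν)
          in
          (con (+ 1) :+ N) :* (w :+ N :* (y :* t :- w)) :=
          γ :* N :+ (con (+ 1) :+ N :* (con (+ 1) :- γ) :+ δ :* v :+ (δ :+ (con (+ 2) :+ ν) :* N :* v) :* u))
          refl ν γ y t
        where
        ν u v α₀ δ₀ ε : ℝ
        ν  = fromℕ n
        u  = 1# - y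
        v  = 1# - t
        α₀ = 1# + (1# + ν) * β
        δ₀ = - (2# + ν)
        ε  = (2# + ν) * (1# + ν)
        0≤u : 0# ≤ u
        0≤u = x≤y⇒0≤y-x y≤1
        0≤v : 0# ≤ v
        0≤v = x≤y⇒0≤y-x t≤1
        u≤β : u ≤ β
        u≤β = +-monoʳ-≤ 1# (neg-mono-≤ γ≤y)
        v≤β : v ≤ β
        v≤β = +-monoʳ-≤ 1# (neg-mono-≤ γ≤t)
        0≤α₀ : 0# ≤ α₀
        0≤α₀ = +-nonneg 0≤1 (*-nonneg (+-nonneg 0≤1 (0≤fromℕ n)) 0≤β)
        0≤γ′ : 0# ≤ α₀ + δ₀ * β
        0≤γ′ = ≤.trans 0≤γ (≤.reflexive (solve 2 (λ ν γ → let β = con (+ 1) :- γ in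
          γ := con (+ 1) :+ (con (+ 1) :+ ν) :* β :+ (:- (con (+ 2) :+ ν)) :* β) refl ν γ))

      0≤w : ∀ {y t} → γ ≤ y → γ ≤ t → 0# ≤ w y t
      0≤w {y} {t} γ≤y γ≤t = ≤.trans (x≤y⇒0≤y-x 1≤2γ) (+-monoˡ-≤ (- 1#)
        (≤.trans (≤.reflexive (solve 1 (λ γ → con (+ 2) :* γ := γ :+ γ) refl γ)) (+-mono-≤ γ≤y γ≤t)))

      w≤yt : ∀ {y t} → y ≤ 1# → t ≤ 1# → w y t ≤ y * t
      w≤yt {y} {t} y≤1 t≤1 = *-nonneg (x≤y⇒0≤y-x y≤1) (x≤y⇒0≤y-x t≤1) ≤-by
        solve 2 (λ y t → y :* t := y :+ t :- con (+ 1) :+ (con (+ 1) :- y) :* (con (+ 1) :- t)) refl y t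

      -- The inequality between the second mixed derivatives.
      derivative-≥ : ∀ n {y t} → γ ≤ y → y ≤ 1# → γ ≤ t → t ≤ 1# →
        γ * fromℕ (suc n) * w y t ^ n ≤ fromℕ (suc (suc n)) * (y ^ suc n * t ^ suc n)
      derivative-≥ n {y} {t} γ≤y y≤1 γ≤t t≤1 = R≤.begin
        γ * fromℕ (suc n) * W
          R≤.≤⟨ *-monoʳ-≤ (^-nonneg n 0≤wyt) (coefficient-≥ n γ≤y y≤1 γ≤t t≤1) ⟩
        fromℕ (suc (suc n)) * (w y t + fromℕ (suc n) * (y * t - w y t)) * W
          R≤.≈⟨ solve 5 (λ M N w e W → M :* (w :+ N :* e) :* W := M :* (N :* e :* W :+ w :* W)) refl
                  (fromℕ (suc (suc n))) (fromℕ (suc n)) (w y t) (y * t - w y t) W ⟩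
        fromℕ (suc (suc n)) * (fromℕ (suc n) * (y * t - w y t) * W + w y t ^ suc n)
          -- The tangent of the power at `w y t`, evaluated at the larger point `y * t`;
          -- `coefficient-≥` is shaped to produce exactly this tangent value.
          R≤.≤⟨ *-monoˡ-≤ (0≤fromℕ (suc (suc n)))
                  (+-monoˡ-≤ _ (^-diff-≥ n 0≤wyt (w≤yt y≤1 t≤1))) ⟩
        fromℕ (suc (suc n)) * ((y * t) ^ suc n - w y t ^ suc n + w y t ^ suc n)
          R≤.≈⟨ *-congˡ (solve 2 (λ a b → a :- b :+ b := a) refl ((y * t) ^ suc n) (w y t ^ suc n)) ⟩
        fromℕ (suc (suc n)) * (y * t) ^ suc n
          R≤.≈⟨ *-congˡ (^-distrib-* y t (suc n)) ⟩
        fromℕ (suc (suc n)) * (y ^ suc n * t ^ suc n)  R≤.∎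
        where
        W = w y t ^ n
        0≤wyt = 0≤w γ≤y γ≤t

    -- For n balls thrown independently, this compares the probability that
    -- the minima in two disjoint buckets lie in given cells with the product
    -- of the two separate probabilities.
    mixed-difference-≤ : ∀ n {x y z t} → γ ≤ y → y ≤ x → x ≤ 1# → γ ≤ t → t ≤ z → z ≤ 1# →
      γ * □ (λ x z → w x z ^ n) x y z t ≤ (x ^ n - y ^ n) * (z ^ n - t ^ n)
    mixed-difference-≤ zero _ _ _ _ _ _ = ≤.reflexive (solve 1 (λ γ → let 1# = con (+ 1) in
      γ :* (1# :- 1# :- 1# :+ 1#) := (1# :- 1#) :* (1# :- 1#)) refl γ)
    mixed-difference-≤ (suc zero) {x} {y} {z} {t} _ y≤x _ _ t≤z _ =
      *-nonneg (x≤y⇒0≤y-x y≤x) (x≤y⇒0≤y-x t≤z) ≤-by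
      solve 5 (λ γ x y z t → let 1# = con (+ 1) in
        (x :* 1# :- y :* 1#) :* (z :* 1# :- t :* 1#) :=
        γ :* ((x :+ z :- 1#) :* 1# :- (y :+ z :- 1#) :* 1# :- (x :+ t :- 1#) :* 1# :+ (y :+ t :- 1#) :* 1#)
          :+ (x :- y) :* (z :- t)) refl γ x y z t
    mixed-difference-≤ (suc (suc n)) {x} {y} {z} {t} γ≤y y≤x x≤1 γ≤t t≤z z≤1 =
      -- The mixed difference of x^m z^m factorises into the right-hand side, so the slack is the
      -- mixed difference of `F`.
      □-nonneg F γ 1# K local x y z t γ≤y y≤x x≤1 γ≤t t≤z z≤1 ≤-by □F≈ x y z t
      where
      m = suc (suc n)
      F : ℝ → ℝ → ℝ
      F x z = x ^ m * z ^ m - γ * w x z ^ m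

      □F≈ : ∀ x y z t → (x ^ m - y ^ m) * (z ^ m - t ^ m) ≈ γ * □ (λ x z → w x z ^ m) x y z t + □ F x y z t
      □F≈ x y z t = solve 9 (λ γ x y z t a b c d → (x :- y) :* (z :- t) :=
          γ :* (a :- b :- c :+ d)
          :+ ((x :* z :- γ :* a) :- (y :* z :- γ :* b) :- (x :* t :- γ :* c) :+ (y :* t :- γ :* d)))
        refl γ (x ^ m) (y ^ m) (z ^ m) (t ^ m) (w x z ^ m) (w y z ^ m) (w x t ^ m) (w y t ^ m)

      -- The constant of the mixed derivative of γ w^m times the Lipschitz constant `fromℕ n` of the
      -- n-th power on [0,1].
      K : ℝ
      K = γ * fromℕ (suc n) * fromℕ m * fromℕ n

      w^-≤ : ∀ n {p q} → 0# ≤ q → q ≤ p → p ≤ 1# → p ^ n ≤ q ^ n + fromℕ n * (p - q)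
      w^-≤ zero {p} {q} _ _ _ = ≤.reflexive (sym (trans (+-congˡ (zeroˡ _)) (+-identityʳ 1#)))
      w^-≤ (suc n) {p} {q} 0≤q q≤p p≤1 = +-nonneg
        (x≤y⇒0≤y-x (^-diff-≤ n 0≤q q≤p))
        (*-nonneg (*-nonneg (0≤fromℕ (suc n)) (x≤y⇒0≤y-x q≤p))
                  (x≤y⇒0≤y-x (^-≤1 n (≤.trans 0≤q q≤p) p≤1))) ≤-by
        solve 5 (λ N e P Q p′ → Q :+ N :* e := P :+ (N :* e :* p′ :- (P :- Q) :+ N :* e :* (con (+ 1) :- p′)))
          refl (fromℕ (suc n)) (p - q) (p ^ suc n) (q ^ suc n) (p ^ n)

      local : ∀ x y z t → γ ≤ y → y ≤ x → x ≤ 1# → γ ≤ t → t ≤ z → z ≤ 1# →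
              - □ F x y z t ≤ K * ((x - y) * (z - t) * ((x - y) + (z - t)))
      local x y z t γ≤y y≤x x≤1 γ≤t t≤z z≤1 = R≤.begin
        - □ F x y z t
          R≤.≈⟨ trans (solve 2 (λ d e → :- d := e :- (e :+ d)) refl (□ F x y z t) (γ * D))
                  (+-congˡ (-‿cong (sym (□F≈ x y z t)))) ⟩
        γ * D - (x ^ m - y ^ m) * (z ^ m - t ^ m)
          -- The first term is estimated from the upper corner of the rectangle, the product from
          -- the lower one.
          R≤.≤⟨ +-mono-≤ (*-monoˡ-≤ 0≤γ (□-w^-≤ 0≤wyt y≤x t≤z n)) (neg-mono-≤
                  (*-mono-≤ (*-nonneg (*-nonneg (0≤fromℕ m) 0≤h) (^-nonneg (suc n) 0≤y))
                            (*-nonneg (*-nonneg (0≤fromℕ m) 0≤k) (^-nonneg (suc n) 0≤t))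
                            (^-diff-≥ (suc n) 0≤y y≤x) (^-diff-≥ (suc n) 0≤t t≤z))) ⟩
        γ * (fromℕ (suc n) * fromℕ m * (h * k) * w x z ^ n)
          - fromℕ m * h * y ^ suc n * (fromℕ m * k * t ^ suc n)
          -- Between the two corners `w` changes by h + k, which costs the third-order term; what
          -- remains is `derivative-≥` at the lower corner.
          R≤.≤⟨ slack ≤-by solve 12 (λ γ N M ν x y z t P W Y T →
                  let h = x :- y ; k = z :- t in
                  γ :* N :* M :* ν :* (h :* k :* (h :+ k)) :=
                  γ :* (N :* M :* (h :* k) :* P) :- M :* h :* Y :* (M :* k :* T)
                    :+ (γ :* N :* M :* (h :* k) :* (W :+ ν :* (x :+ z :- con (+ 1) :- (y :+ t :- con (+ 1))) :- P)
                      :+ M :* (h :* k) :* (M :* (Y :* T) :- γ :* N :* W)))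
                refl γ (fromℕ (suc n)) (fromℕ m) (fromℕ n) x y z t (w x z ^ n) (w y t ^ n) (y ^ suc n) (t ^ suc n) ⟩
        K * (h * k * (h + k))  R≤.∎
        where
        h = x - y
        k = z - t
        D = □ (λ x z → w x z ^ m) x y z t
        0≤h = x≤y⇒0≤y-x y≤x
        0≤k = x≤y⇒0≤y-x t≤z
        0≤y = ≤.trans 0≤γ γ≤y
        0≤t = ≤.trans 0≤γ γ≤t
        0≤wyt = 0≤w γ≤y γ≤t
        wyt≤wxz : w y t ≤ w x z
        wyt≤wxz = +-monoˡ-≤ (- 1#) (+-mono-≤ y≤x t≤z)
        wxz≤1 : w x z ≤ 1#
        wxz≤1 = ≤.trans (+-monoˡ-≤ (- 1#) (+-mono-≤ x≤1 z≤1))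
          (≤.reflexive (solve 0 (con (+ 1) :+ con (+ 1) :- con (+ 1) := con (+ 1)) refl))
        slack = +-nonneg
          (*-nonneg (*-nonneg (*-nonneg (*-nonneg 0≤γ (0≤fromℕ (suc n))) (0≤fromℕ m)) (*-nonneg 0≤h 0≤k))
                    (x≤y⇒0≤y-x (w^-≤ n 0≤wyt wyt≤wxz wxz≤1)))
          (*-nonneg (*-nonneg (0≤fromℕ m) (*-nonneg 0≤h 0≤k))
                    (x≤y⇒0≤y-x (derivative-≥ n γ≤y (≤.trans y≤x x≤1) γ≤t (≤.trans t≤z z≤1))))

-- Events, finite additivity and variables with natural values

module FiniteProbability {R : Reals} (P : ProbabilitySpace R) where
  open Reals R
  open OrderedFieldProperties orderedField
  open ProbabilitySpace P
  open RawMonoidDefs ℕ.+-0-rawMonoid using () renaming (sum to sumℕ)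
  open import Relation.Binary.Reasoning.Setoid setoid

  -- Measurable sets are closed under intersection only if double negations
  -- can be removed, so decidability is carried along.
  record IsEvent (E : Pred Ω 0ℓ) : Set₁ where
    constructor event
    field
      dec        : Decidable E
      measurable : Measurable E
  open IsEvent public

  event-≐ : ∀ {E F} → E ≐ F → IsEvent E → IsEvent F
  event-≐ (E⊆F , F⊆E) (event E? E-meas) = event dec-F (measurable-≐ (E⊆F , F⊆E) E-meas)
    where
    dec-F : Decidable _
    dec-F ω with E? ω
    ... | yes ω∈E = yes (E⊆F ω∈E)
    ... | no  ω∉E = no (ω∉E ∘ F⊆E)

  event-U : IsEvent U
  event-U = event (λ _ → yes tt) measurable-U

  event-∁ : ∀ {E} → IsEvent E → IsEvent (∁ E)
  event-∁ (event E? E-meas) = event (λ ω → ¬? (E? ω)) (measurable-∁ E-meas)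

  event-∅ : IsEvent ∅
  event-∅ = event-≐ ((λ ¬tt → ¬tt tt) , λ ()) (event-∁ event-U)

  private
    -- Two events padded with empty ones to a sequence, the form in which countable unions and
    -- countable additivity are given.
    pair : Pred Ω 0ℓ → Pred Ω 0ℓ → ℕ → Pred Ω 0ℓ
    pair E F 0             = E
    pair E F 1             = F
    pair E F (suc (suc _)) = ∅

    pair-measurable : ∀ {E F} → IsEvent E → IsEvent F → ∀ k → Measurable (pair E F k)
    pair-measurable E F 0             = measurable E
    pair-measurable E F 1             = measurable F
    pair-measurable E F (suc (suc _)) = measurable event-∅

    ⋃-pair : ∀ E F → ⋃ ℕ (pair E F) ≐ E ∪ F
    ⋃-pair E F = (λ { (0 , ω∈E) → inj₁ ω∈E ; (1 , ω∈F) → inj₂ ω∈F })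
               , (λ { (inj₁ ω∈E) → 0 , ω∈E ; (inj₂ ω∈F) → 1 , ω∈F })

  event-∪ : ∀ {E F} → IsEvent E → IsEvent F → IsEvent (E ∪ F)
  event-∪ {E} {F} E-ev F-ev = event (λ ω → dec E-ev ω ⊎-dec dec F-ev ω)
    (measurable-≐ (⋃-pair E F) (measurable-⋃ _ (pair-measurable E-ev F-ev)))

  event-∩ : ∀ {E F} → IsEvent E → IsEvent F → IsEvent (E ∩ F)
  event-∩ {E} {F} E-ev F-ev = event-≐
    ( (λ {ω} ω∉ → decidable-stable (dec E-ev ω) (ω∉ ∘ inj₁) , decidable-stable (dec F-ev ω) (ω∉ ∘ inj₂))
    , (λ (ω∈E , ω∈F) → [ (λ ω∉E → ω∉E ω∈E) , (λ ω∉F → ω∉F ω∈F) ]))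
    (event-∁ (event-∪ (event-∁ E-ev) (event-∁ F-ev)))

  -- Extracts finite from countable additivity: along a padded sequence the partial sums become
  -- stationary.
  limit-of-constant : ∀ {s c l} N → (∀ n → N ℕ.≤ n → s n ≈ c) → s ⟶ l → c ≈ l
  limit-of-constant {s} {c} {l} N s≈c s⟶l = ≤.antisym
    (within (λ ε 0<ε → proj₁ (near ε 0<ε))) (within (λ ε 0<ε → proj₂ (near ε 0<ε)))
    where
    near : ∀ ε → 0# < ε → c < l + ε × l < c + ε
    near ε 0<ε with s⟶l ε 0<ε
    ... | N′ , close with close (N ℕ.+ N′) (ℕₚ.m≤n+m N′ N)
    ...   | s<l+ε , l<s+ε = ≤-<-trans (≤.reflexive (sym sn≈c)) s<l+ε
                          , <-≤-trans l<s+ε (≤.reflexive (+-congʳ sn≈c))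
      where sn≈c = s≈c (N ℕ.+ N′) (ℕₚ.m≤m+n N N′)

    within : ∀ {x y} → (∀ ε → 0# < ε → x < y + ε) → x ≤ y
    within {x} {y} x<y+ε = ≮⇒≥ λ y<x → <⇒≱
      (x<y+ε (x - y) (x<y⇒0<y-x y<x))
      (≤.reflexive (solve 2 (λ x y → y :+ (x :- y) := x) refl x y))

  ℙ-∪ : ∀ {E F} → IsEvent E → IsEvent F → (∀ {ω} → ω ∈ E → ¬ ω ∈ F) → ℙ (E ∪ F) ≈ ℙ E + ℙ F
  ℙ-∪ {E} {F} E-ev F-ev disjoint = sym (trans
    (limit-of-constant 2 stationary (ℙ-⋃ (pair E F) (pair-measurable E-ev F-ev) disjoint′))
    (ℙ-≐ (⋃-pair E F)))
    where
    disjoint′ : ∀ {j k} → j ≢ k → ∀ ω → ¬ (ω ∈ pair E F j × ω ∈ pair E F k)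
    disjoint′ {0} {0} j≢k _ _ = j≢k ≡.refl
    disjoint′ {0} {1} _ _ (ω∈E , ω∈F) = disjoint ω∈E ω∈F
    disjoint′ {1} {0} _ _ (ω∈F , ω∈E) = disjoint ω∈E ω∈F
    disjoint′ {1} {1} j≢k _ _ = j≢k ≡.refl
    disjoint′ {suc (suc _)} _ _ (() , _)
    disjoint′ {_} {suc (suc _)} _ _ (_ , ())

    stationary : ∀ n → 2 ℕ.≤ n → partialSum (ℙ ∘ pair E F) n ≈ ℙ E + ℙ F
    stationary (suc (suc n)) _ = +-congˡ (trans
      (+-congˡ (trans (sum-cong-≋ {n} (λ _ → ℙ-∅)) (sum-replicate-zero n))) (+-identityʳ _))
    stationary (suc zero) (s≤s ())

  ℙ-split : ∀ {E F} → IsEvent E → IsEvent F → ℙ E ≈ ℙ (E ∩ F) + ℙ (E ∩ ∁ F)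
  ℙ-split {E} {F} E-ev F-ev = trans
    (ℙ-≐ (split , [ proj₁ , proj₁ ]))
    (ℙ-∪ (event-∩ E-ev F-ev) (event-∩ E-ev (event-∁ F-ev)) (λ (_ , ω∈F) (_ , ω∉F) → ω∉F ω∈F))
    where
    split : E ⊆ (E ∩ F) ∪ (E ∩ ∁ F)
    split {ω} ω∈E with dec F-ev ω
    ... | yes ω∈F = inj₁ (ω∈E , ω∈F)
    ... | no  ω∉F = inj₂ (ω∈E , ω∉F)

  ℙ-∖ : ∀ {E F} → IsEvent E → IsEvent F → F ⊆ E → ℙ (E ∩ ∁ F) ≈ ℙ E - ℙ F
  ℙ-∖ {E} {F} E-ev F-ev F⊆E = sym (begin
    ℙ E - ℙ F                           ≈⟨ +-congʳ (ℙ-split E-ev F-ev) ⟩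
    ℙ (E ∩ F) + ℙ (E ∩ ∁ F) - ℙ F       ≈⟨ +-congʳ (+-congʳ (ℙ-≐ (proj₂ , λ ω∈F → F⊆E ω∈F , ω∈F))) ⟩
    ℙ F + ℙ (E ∩ ∁ F) - ℙ F             ≈⟨ solve 2 (λ a b → a :+ b :- a := b) refl (ℙ F) (ℙ (E ∩ ∁ F)) ⟩
    ℙ (E ∩ ∁ F)                         ∎)

  ℙ-∁ : ∀ {E} → IsEvent E → ℙ (∁ E) ≈ 1# - ℙ E
  ℙ-∁ E-ev = trans (ℙ-≐ ((λ ω∉E → tt , ω∉E) , proj₂)) (trans (ℙ-∖ event-U E-ev (λ _ → tt)) (+-congʳ ℙ-U))

  ℙ-mono : ∀ {E F} → IsEvent E → IsEvent F → E ⊆ F → ℙ E ≤ ℙ F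
  ℙ-mono {E} {F} E-ev F-ev E⊆F = ℙ-nonneg (measurable (event-∩ F-ev (event-∁ E-ev))) ≤-by
    trans (ℙ-split F-ev E-ev) (+-congʳ (ℙ-≐ (proj₂ , λ ω∈E → E⊆F ω∈E , ω∈E)))

  RandomVariable : (Ω → ℕ) → Set₁
  RandomVariable X = ∀ k → Measurable (λ ω → X ω ≡ k)

  module _ {X : Ω → ℕ} (X-rv : RandomVariable X) where

    event-≡ : ∀ k → IsEvent (λ ω → X ω ≡ k)
    event-≡ k = event (λ ω → X ω ℕₚ.≟ k) (X-rv k)

    event-∈ : ∀ {S : Pred ℕ 0ℓ} → Decidable S → IsEvent (λ ω → S (X ω))
    event-∈ {S} S? = event (λ ω → S? (X ω))
      (measurable-≐ ((λ { (_ , ≡.refl , s) → s }) , λ s → _ , ≡.refl , s) (measurable-⋃ _ slice))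
      where
      slice : ∀ k → Measurable (λ ω → X ω ≡ k × S k)
      slice k with S? k
      ... | yes s  = measurable-≐ ((λ Xω≡k → Xω≡k , s) , proj₁) (X-rv k)
      ... | no  ¬s = measurable-≐ ((λ ()) , λ (_ , s) → ⊥-elim (¬s s)) (measurable event-∅)

    event-≥ : ∀ k → IsEvent (λ ω → k ℕ.≤ X ω)
    event-≥ k = event-∈ (k ℕₚ.≤?_)

    -- Independence evaluates tails, because a minimum is at least k exactly when all values are;
    -- point probabilities come back as differences. `Q` holds what is required of other variables.
    ℙ-≡ : ∀ {Q} → IsEvent Q → ∀ k →
      ℙ (Q ∩ λ ω → X ω ≡ k) ≈ ℙ (Q ∩ λ ω → k ℕ.≤ X ω) - ℙ (Q ∩ λ ω → suc k ℕ.≤ X ω)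
    ℙ-≡ {Q} Q-ev k = trans (ℙ-≐
      ( (λ { (q , ≡.refl) → (q , ℕₚ.≤-refl) , (λ (_ , k<k) → ℕₚ.<-irrefl ≡.refl k<k) })
      , (λ ((q , k≤X) , ≮) → q , ℕₚ.≤-antisym (ℕₚ.≮⇒≥ (λ k<X → ≮ (q , k<X))) k≤X)))
      (ℙ-∖ (event-∩ Q-ev (event-≥ k)) (event-∩ Q-ev (event-≥ (suc k)))
        (λ (q , k<X) → q , ℕₚ.<⇒≤ k<X))

    total-probability : ∀ {Q} → IsEvent Q → ∀ n →
      ℙ (Q ∩ λ ω → X ω ℕ.< n) ≈ sum {n} (λ k → ℙ (Q ∩ λ ω → X ω ≡ toℕ k))
    total-probability {Q} Q-ev zero = trans (ℙ-≐ ((λ ()) , λ ())) ℙ-∅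
    total-probability {Q} Q-ev (suc n) = begin
      ℙ (Q ∩ λ ω → X ω ℕ.< suc n)
        ≈⟨ ℙ-≐ ( (λ {ω} (q , X<1+n) → [ (λ X<n → inj₁ (q , X<n)) , (λ X≡n → inj₂ (q , X≡n)) ]
                                       (ℕₚ.m≤n⇒m<n∨m≡n (ℕₚ.≤-pred X<1+n)))
               , [ (λ (q , X<n) → q , ℕₚ.m<n⇒m<1+n X<n) , (λ { (q , ≡.refl) → q , ℕₚ.≤-refl }) ]) ⟩
      ℙ ((Q ∩ λ ω → X ω ℕ.< n) ∪ (Q ∩ λ ω → X ω ≡ n))
        ≈⟨ ℙ-∪ (event-∩ Q-ev (event-∈ (ℕₚ._<? n))) (event-∩ Q-ev (event-≡ n))
               (λ { (_ , X<n) (_ , ≡.refl) → ℕₚ.<-irrefl ≡.refl X<n }) ⟩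
      ℙ (Q ∩ λ ω → X ω ℕ.< n) + ℙ (Q ∩ λ ω → X ω ≡ n)
        ≈⟨ +-cong (total-probability Q-ev n) (reflexive (≡.cong p (≡.sym (Finₚ.toℕ-fromℕ n)))) ⟩
      sum {n} (λ k → p (toℕ k)) + p (toℕ (Fin.fromℕ n))
        ≈⟨ +-congʳ (sum-cong-≋ {n} (λ k → reflexive (≡.cong p (≡.sym (Finₚ.toℕ-inject₁ k))))) ⟩
      sum {n} (λ k → p (toℕ (Fin.inject₁ k))) + p (toℕ (Fin.fromℕ n))
        ≈⟨ sum-init-last +-monoid {n} (λ k → p (toℕ k)) ⟨
      sum {suc n} (λ k → p (toℕ k)) ∎
      where
      p : ℕ → ℝ
      p k = ℙ (Q ∩ λ ω → X ω ≡ k)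

  -- Differencing the joint tail once in each variable produces the sign pattern of `□`.
  ℙ-≡-≡ : ∀ {X Y Q} → RandomVariable X → RandomVariable Y → IsEvent Q → ∀ k l →
    let tail = λ (k l : ℕ) → ℙ (Q ∩ ((λ ω → k ℕ.≤ X ω) ∩ (λ ω → l ℕ.≤ Y ω))) in
    ℙ (Q ∩ ((λ ω → X ω ≡ k) ∩ (λ ω → Y ω ≡ l)))
      ≈ tail k l - tail (suc k) l - tail k (suc l) + tail (suc k) (suc l)
  ℙ-≡-≡ {X} {Y} {Q} X-rv Y-rv Q-ev k l = begin
    ℙ (Q ∩ (X≡ k ∩ Y≡ l))
      ≈⟨ ℙ-≐ ((λ (q , x , y) → (q , x) , y) , (λ ((q , x) , y) → q , x , y)) ⟩
    ℙ ((Q ∩ X≡ k) ∩ Y≡ l)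
      ≈⟨ ℙ-≡ Y-rv (event-∩ Q-ev (event-≡ X-rv k)) l ⟩
    ℙ ((Q ∩ X≡ k) ∩ Y≥ l) - ℙ ((Q ∩ X≡ k) ∩ Y≥ (suc l))
      ≈⟨ +-cong (step l) (-‿cong (step (suc l))) ⟩
    tail k l - tail (suc k) l - (tail k (suc l) - tail (suc k) (suc l))
      ≈⟨ solve 4 (λ a b c d → a :- b :- (c :- d) := a :- b :- c :+ d) refl _ _ _ _ ⟩
    tail k l - tail (suc k) l - tail k (suc l) + tail (suc k) (suc l) ∎
    where
    X≡ Y≡ X≥ Y≥ : ℕ → Pred Ω 0ℓ
    X≡ k ω = X ω ≡ k
    Y≡ l ω = Y ω ≡ l
    X≥ k ω = k ℕ.≤ X ω
    Y≥ l ω = l ℕ.≤ Y ω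
    tail : ℕ → ℕ → ℝ
    tail k l = ℙ (Q ∩ (X≥ k ∩ Y≥ l))
    rotate : ∀ {E F G : Pred Ω 0ℓ} → ℙ ((E ∩ F) ∩ G) ≈ ℙ ((E ∩ G) ∩ F)
    rotate = ℙ-≐ ((λ ((e , f) , g) → (e , g) , f) , (λ ((e , g) , f) → (e , f) , g))
    assoc : ∀ k l → ℙ ((Q ∩ Y≥ l) ∩ X≥ k) ≈ tail k l
    assoc k l = ℙ-≐ ((λ ((q , y) , x) → q , x , y) , (λ (q , x , y) → (q , y) , x))
    step : ∀ l → ℙ ((Q ∩ X≡ k) ∩ Y≥ l) ≈ tail k l - tail (suc k) l
    step l = trans rotate (trans (ℙ-≡ X-rv (event-∩ Q-ev (event-≥ Y-rv l)) k)
      (+-cong (assoc k l) (-‿cong (assoc (suc k) l))))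

  event-∈₂ : ∀ {X Y} {S : ℕ → ℕ → Set} → RandomVariable X → RandomVariable Y →
             (∀ x y → Dec (S x y)) → IsEvent (λ ω → S (X ω) (Y ω))
  event-∈₂ {X} {Y} X-rv Y-rv S? = event (λ ω → S? (X ω) (Y ω)) (measurable-≐
    ((λ { (_ , ≡.refl , s) → s }) , λ s → _ , ≡.refl , s)
    (measurable-⋃ _ λ x → measurable (event-∩ (event-≡ X-rv x) (event-∈ Y-rv (S? x)))))

  rv-map₂ : ∀ {X Y} (f : ℕ → ℕ → ℕ) → RandomVariable X → RandomVariable Y →
            RandomVariable (λ ω → f (X ω) (Y ω))
  rv-map₂ f X-rv Y-rv k = measurable (event-∈₂ X-rv Y-rv (λ x y → f x y ℕₚ.≟ k))

  rv-const : ∀ c → RandomVariable (λ _ → c)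
  rv-const c k with c ℕₚ.≟ k
  ... | yes c≡k = measurable-≐ ((λ _ → c≡k) , λ _ → tt) measurable-U
  ... | no  c≢k = measurable-≐ ((λ ()) , λ c≡k → ⊥-elim (c≢k c≡k)) (measurable event-∅)

  rv-sum : ∀ {n} {Z : Fin n → Ω → ℕ} → (∀ i → RandomVariable (Z i)) →
           RandomVariable (λ ω → sumℕ (λ i → Z i ω))
  rv-sum {zero}  Z-rv = rv-const 0
  rv-sum {suc n} Z-rv = rv-map₂ ℕ._+_ (Z-rv Fin.zero) (rv-sum (Z-rv ∘ Fin.suc))

  rv-of-tails : ∀ {X} → (∀ k → IsEvent (λ ω → k ℕ.≤ X ω)) → RandomVariable X
  rv-of-tails tails k = measurable (event-≐
    ( (λ (k≤X , k≮X) → ℕₚ.≤-antisym (ℕₚ.≮⇒≥ k≮X) k≤X)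
    , (λ { ≡.refl → ℕₚ.≤-refl , ℕₚ.<-irrefl ≡.refl }))
    (event-∩ (tails k) (event-∁ (tails (suc k)))))

  -- The substitute for linearity of expectation on an event where the sum is constant. `E` is split
  -- by the first indicator: on `E₁` the others sum to one less, on `E₀` still to k.
  Σ-indicators : ∀ {n} (Z : Fin n → Ω → ℕ) → (∀ i → RandomVariable (Z i)) → (∀ i ω → Z i ω ℕ.≤ 1) →
    ∀ {E} k → IsEvent E → (∀ {ω} → ω ∈ E → sumℕ (λ i → Z i ω) ≡ k) →
    sum (λ i → ℙ (E ∩ λ ω → Z i ω ≡ 1)) ≈ fromℕ k * ℙ E
  Σ-indicators {zero} Z _ _ zero _ _ = sym (zeroˡ _)
  Σ-indicators {zero} Z _ _ (suc k) _ E⊆ = sym (trans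
    (*-congˡ (trans (ℙ-≐ ((λ ω∈E → ⊥-elim (ℕₚ.0≢1+n (E⊆ ω∈E))) , λ ())) ℙ-∅)) (zeroʳ _))
  Σ-indicators {suc n} Z Z-rv Z≤1 {E} k E-ev E⊆ = begin
    ℙ E₁ + sum {n} (λ i → ℙ (E ∩ Z≡1 (Fin.suc i)))
      ≈⟨ +-congˡ (trans (sum-cong-≋ {n} (λ i → trans
           (ℙ-split (event-∩ E-ev (event-≡ (Z-rv (Fin.suc i)) 1)) (event-≡ (Z-rv Fin.zero) 1))
           (+-cong rotate rotate)))
           (∑-distrib-+ {n} (λ i → ℙ (E₁ ∩ Z≡1 (Fin.suc i))) (λ i → ℙ (E₀ ∩ Z≡1 (Fin.suc i))))) ⟩
    ℙ E₁ + (sum {n} (λ i → ℙ (E₁ ∩ Z≡1 (Fin.suc i))) + sum {n} (λ i → ℙ (E₀ ∩ Z≡1 (Fin.suc i))))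
      ≈⟨ solve 3 (λ a b c → a :+ (b :+ c) := a :+ b :+ c) refl _ _ _ ⟩
    ℙ E₁ + sum {n} (λ i → ℙ (E₁ ∩ Z≡1 (Fin.suc i))) + sum {n} (λ i → ℙ (E₀ ∩ Z≡1 (Fin.suc i)))
      ≈⟨ +-cong (on-E₁ k E⊆) (Σ-indicators (Z ∘ Fin.suc) (Z-rv ∘ Fin.suc) (Z≤1 ∘ Fin.suc) k E₀-ev E₀⊆) ⟩
    fromℕ k * ℙ E₁ + fromℕ k * ℙ E₀
      ≈⟨ distribˡ (fromℕ k) _ _ ⟨
    fromℕ k * (ℙ E₁ + ℙ E₀)
      ≈⟨ *-congˡ (ℙ-split E-ev (event-≡ (Z-rv Fin.zero) 1)) ⟨
    fromℕ k * ℙ E ∎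
    where
    Z≡1 : Fin (suc n) → Pred Ω 0ℓ
    Z≡1 i ω = Z i ω ≡ 1
    E₁ E₀ : Pred Ω 0ℓ
    E₁ = E ∩ Z≡1 Fin.zero
    E₀ = E ∩ ∁ (Z≡1 Fin.zero)
    E₁-ev = event-∩ E-ev (event-≡ (Z-rv Fin.zero) 1)
    E₀-ev = event-∩ E-ev (event-∁ (event-≡ (Z-rv Fin.zero) 1))

    rotate : ∀ {E F G : Pred Ω 0ℓ} → ℙ ((E ∩ F) ∩ G) ≈ ℙ ((E ∩ G) ∩ F)
    rotate = ℙ-≐ ((λ ((e , f) , g) → (e , g) , f) , (λ ((e , g) , f) → (e , f) , g))

    E₀⊆ : ∀ {ω} → ω ∈ E₀ → sumℕ (λ i → Z (Fin.suc i) ω) ≡ k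
    E₀⊆ {ω} (ω∈E , Z₀≢1) = ≡.trans
      (≡.cong (ℕ._+ sumℕ (λ i → Z (Fin.suc i) ω))
        (≡.sym (ℕₚ.n<1⇒n≡0 (ℕₚ.≤∧≢⇒< (Z≤1 Fin.zero ω) Z₀≢1))))
      (E⊆ ω∈E)

    on-E₁ : ∀ k → (∀ {ω} → ω ∈ E → sumℕ (λ i → Z i ω) ≡ k) →
            ℙ E₁ + sum {n} (λ i → ℙ (E₁ ∩ Z≡1 (Fin.suc i))) ≈ fromℕ k * ℙ E₁
    on-E₁ zero E⊆ = trans (+-cong ℙE₁≈0 (trans
        (sum-cong-≋ {n} (λ i → trans (ℙ-≐ ((λ (e , _) → ⊥-elim (empty e)) , λ ())) ℙ-∅))
        (sum-replicate-zero n)))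
      (trans (+-identityʳ 0#) (sym (zeroˡ _)))
      where
      empty : ∀ {ω} → ¬ ω ∈ E₁
      empty {ω} (ω∈E , Z₀≡1) = ℕₚ.1+n≢0 (≡.trans
        (≡.cong (ℕ._+ sumℕ (λ i → Z (Fin.suc i) ω)) (≡.sym Z₀≡1)) (E⊆ ω∈E))
      ℙE₁≈0 = trans (ℙ-≐ ((λ e → ⊥-elim (empty e)) , λ ())) ℙ-∅
    on-E₁ (suc k) E⊆ = trans
      (+-cong (sym (*-identityˡ _)) (Σ-indicators (Z ∘ Fin.suc) (Z-rv ∘ Fin.suc) (Z≤1 ∘ Fin.suc) k E₁-ev
        (λ {ω} (ω∈E , Z₀≡1) → ℕₚ.suc-injective (≡.trans
          (≡.cong (ℕ._+ sumℕ (λ i → Z (Fin.suc i) ω)) (≡.sym Z₀≡1)) (E⊆ ω∈E)))))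
      (sym (distribʳ _ _ _))

-- The first two moments of a sum of indicators

module Moments {R : Reals} (P : ProbabilitySpace R) where
  open Reals R
  open OrderedFieldProperties orderedField
  open ProbabilitySpace P
  open FiniteProbability P
  open RawMonoidDefs ℕ.+-0-rawMonoid using () renaming (sum to sumℕ)
  open import Relation.Binary.Reasoning.Setoid setoid

  module _ {N : ℕ} {Z : Fin N → Ω → ℕ} (Z-rv : ∀ i → RandomVariable (Z i))
           (Z≤1 : ∀ i ω → Z i ω ℕ.≤ 1) where
    private
      X : Ω → ℕ
      X ω = sumℕ (λ i → Z i ω)

      X-rv : RandomVariable X
      X-rv = rv-sum Z-rv

      Z₁ : Fin N → Pred Ω 0ℓ
      Z₁ i ω = Z i ω ≡ 1

      Z₁-event : ∀ i → IsEvent (Z₁ i)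
      Z₁-event i = event-≡ (Z-rv i) 1

    module _ {b : ℕ} (X<b : ∀ ω → X ω ℕ.< b) where
      level : ℕ → Pred Ω 0ℓ
      level k ω = X ω ≡ k

      ∑-levels : ∀ {Q} → IsEvent Q → sum {b} (λ k → ℙ (level (toℕ k) ∩ Q)) ≈ ℙ Q
      ∑-levels {Q} Q-ev = trans
        (trans (sum-cong-≋ {b} (λ _ → ℙ-≐ (swap , swap))) (sym (total-probability X-rv Q-ev b)))
        (ℙ-≐ (proj₁ , λ {ω} q → q , X<b ω))

      moment₁ : sum {b} (λ k → fromℕ (toℕ k) * ℙ (level (toℕ k))) ≈ sum (λ i → ℙ (Z₁ i))
      moment₁ = begin
        sum {b} (λ k → fromℕ (toℕ k) * ℙ (level (toℕ k)))
          ≈⟨ sum-cong-≋ {b} (λ k → Σ-indicators Z Z-rv Z≤1 (toℕ k) (event-≡ X-rv (toℕ k)) id) ⟨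
        sum {b} (λ k → sum {N} (λ i → ℙ (level (toℕ k) ∩ Z₁ i)))
          ≈⟨ ∑-comm {b} {N} (λ k i → ℙ (level (toℕ k) ∩ Z₁ i)) ⟩
        sum {N} (λ i → sum {b} (λ k → ℙ (level (toℕ k) ∩ Z₁ i)))
          ≈⟨ sum-cong-≋ {N} (λ i → ∑-levels (Z₁-event i)) ⟩
        sum {N} (λ i → ℙ (Z₁ i)) ∎

      -- `Σ-indicators` absorbs one factor k on the level set and the other on its intersection with
      -- `Z₁ i`, where the sum is still k.
      moment₂ : sum {b} (λ k → fromℕ (toℕ k) * (fromℕ (toℕ k) * ℙ (level (toℕ k))))
                  ≈ sum {N} (λ i → sum {N} (λ j → ℙ (Z₁ i ∩ Z₁ j)))
      moment₂ = begin
        sum {b} (λ k → fromℕ (toℕ k) * (fromℕ (toℕ k) * ℙ (level (toℕ k))))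
          ≈⟨ sum-cong-≋ {b} (λ k → *-congˡ
               (sym (Σ-indicators Z Z-rv Z≤1 (toℕ k) (event-≡ X-rv (toℕ k)) id))) ⟩
        sum {b} (λ k → fromℕ (toℕ k) * sum {N} (λ i → ℙ (level (toℕ k) ∩ Z₁ i)))
          ≈⟨ sum-cong-≋ {b} (λ k → *-distribˡ-sum {N} (fromℕ (toℕ k)) _) ⟩
        sum {b} (λ k → sum {N} (λ i → fromℕ (toℕ k) * ℙ (level (toℕ k) ∩ Z₁ i)))
          ≈⟨ sum-cong-≋ {b} (λ k → sum-cong-≋ {N} (λ i → sym
               (Σ-indicators Z Z-rv Z≤1 (toℕ k) (event-∩ (event-≡ X-rv (toℕ k)) (Z₁-event i)) proj₁))) ⟩
        sum {b} (λ k → sum {N} (λ i → sum {N} (λ j → ℙ ((level (toℕ k) ∩ Z₁ i) ∩ Z₁ j))))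
          ≈⟨ ∑-comm {b} {N} (λ k i → sum {N} (λ j → ℙ ((level (toℕ k) ∩ Z₁ i) ∩ Z₁ j))) ⟩
        sum {N} (λ i → sum {b} (λ k → sum {N} (λ j → ℙ ((level (toℕ k) ∩ Z₁ i) ∩ Z₁ j))))
          ≈⟨ sum-cong-≋ {N} (λ i → ∑-comm {b} {N} (λ k j → ℙ ((level (toℕ k) ∩ Z₁ i) ∩ Z₁ j))) ⟩
        sum {N} (λ i → sum {N} (λ j → sum {b} (λ k → ℙ ((level (toℕ k) ∩ Z₁ i) ∩ Z₁ j))))
          ≈⟨ sum-cong-≋ {N} (λ i → sum-cong-≋ {N} (λ j → trans
               (sum-cong-≋ {b} (λ k →
                  ℙ-≐ ((λ ((x , i) , j) → x , i , j) , (λ (x , i , j) → (x , i) , j))))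
               (∑-levels (event-∩ (Z₁-event i) (Z₁-event j))))) ⟩
        sum {N} (λ i → sum {N} (λ j → ℙ (Z₁ i ∩ Z₁ j))) ∎

      variance : ∀ μ → sum {b} (λ k → fromℕ (toℕ k) * ℙ (level (toℕ k))) ≈ μ →
        sum {b} (λ k → (fromℕ (toℕ k) - μ) ^ 2 * ℙ (level (toℕ k)))
          ≈ sum {N} (λ i → sum {N} (λ j → ℙ (Z₁ i ∩ Z₁ j))) - μ * μ
      variance μ mean = begin
        sum {b} (λ k → (fromℕ (toℕ k) - μ) ^ 2 * p k)
          ≈⟨ sum-cong-≋ {b} (λ k → solve 3 (λ k μ p →
               (k :- μ) :* ((k :- μ) :* con (+ 1)) :* p :=
               k :* (k :* p) :+ (:- (con (+ 2) :* μ) :* (k :* p) :+ μ :* μ :* p)) refl (fromℕ (toℕ k)) μ (p k)) ⟩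
        sum {b} (λ k → s k + (- (2# * μ) * t k + μ * μ * p k))
          ≈⟨ trans (∑-distrib-+ {b} s _) (+-congˡ (trans (∑-distrib-+ {b} (λ k → - (2# * μ) * t k) _)
               (+-cong (sym (*-distribˡ-sum {b} (- (2# * μ)) t)) (sym (*-distribˡ-sum {b} (μ * μ) p))))) ⟩
        sum {b} s + (- (2# * μ) * sum {b} t + μ * μ * sum {b} p)
          ≈⟨ +-cong moment₂ (+-cong (*-congˡ mean) (*-congˡ ∑p≈1)) ⟩
        M₂ + (- (2# * μ) * μ + μ * μ * 1#)
          ≈⟨ solve 2 (λ m μ → m :+ (:- (con (+ 2) :* μ) :* μ :+ μ :* μ :* con (+ 1)) := m :- μ :* μ) refl M₂ μ ⟩
        M₂ - μ * μ ∎
        where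
        M₂ = sum {N} (λ i → sum {N} (λ j → ℙ (Z₁ i ∩ Z₁ j)))
        p s t : Fin b → ℝ
        p k = ℙ (level (toℕ k))
        t k = fromℕ (toℕ k) * p k
        s k = fromℕ (toℕ k) * t k
        ∑p≈1 : sum p ≈ 1#
        ∑p≈1 = trans (sum-cong-≋ {b} (λ k → ℙ-≐ ((λ x → x , tt) , proj₁)))
                 (trans (∑-levels event-U) ℙ-U)

    module _ {b : ℕ} (X≤b : ∀ ω → X ω ℕ.≤ b) where

      Mean-Σ : Mean X X≤b ≈ sum (λ i → ℙ (Z₁ i))
      Mean-Σ = moment₁ (s≤s ∘ X≤b)

      Var-Σ : let μ = Mean X X≤b in
        Var X X≤b ≈ sum {N} (λ i → sum {N} (λ j → ℙ (Z₁ i ∩ Z₁ j))) - μ * μ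
      Var-Σ = variance (s≤s ∘ X≤b) (Mean X X≤b) refl

  private
    δ : ∀ {n} → Fin n → Fin n → ℝ → ℝ
    δ i j x = if does (i Finₚ.≟ j) then x else 0#

    sum-δ : ∀ {n} (i : Fin n) x → sum {n} (λ j → δ i j x) ≈ x
    sum-δ {suc n} Fin.zero    x = trans (+-congˡ (sum-replicate-zero n)) (+-identityʳ x)
    sum-δ {suc n} (Fin.suc i) x = trans (+-identityˡ _) (sum-δ i x)

  -- Cauchy–Schwarz against the constant vector β, where N * β ≈ 1.
  mean²≤sum-of-squares : ∀ {N} (x : Vector ℝ N) {β} → fromℕ N * β ≈ 1# →
    β * (sum x * sum x) ≤ sum (λ i → x i * x i)
  -- The slack is the sum of squared deviations from the average c = β μ.
  mean²≤sum-of-squares {N} x {β} Nβ≈1 = sum-nonneg {N} (λ i → 0≤x² (x i - c)) ≤-by (begin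
      sum x²
        ≈⟨ solve 3 (λ s μ β → s :=
             β :* (μ :* μ) :+ (s :+ (:- (con (+ 2) :* (β :* μ)) :* μ :+ con (+ 1) :* (β :* μ :* μ)))) refl (sum x²) μ β ⟩
      β * (μ * μ) + (sum x² + (- (2# * c) * μ + 1# * (c * μ)))
        ≈⟨ +-congˡ (+-congˡ (+-congˡ (*-congʳ Nβ≈1))) ⟨
      β * (μ * μ) + (sum x² + (- (2# * c) * μ + fromℕ N * β * (c * μ)))
        ≈⟨ +-congˡ (+-congˡ (+-cong (*-distribˡ-sum {N} (- (2# * c)) x)
             (trans (solve 3 (λ n b m → n :* b :* (b :* m :* m) := n :* (b :* m :* (b :* m))) refl (fromℕ N) β μ)
                    (sym (sum-const N (c * c)))))) ⟩
      β * (μ * μ) + (sum x² + (sum {N} (λ i → - (2# * c) * x i) + sum {N} (λ _ → c * c)))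
        ≈⟨ +-congˡ (trans (∑-distrib-+ {N} x² _) (+-congˡ (∑-distrib-+ {N} (λ i → - (2# * c) * x i) _))) ⟨
      β * (μ * μ) + sum {N} (λ i → x i * x i + (- (2# * c) * x i + c * c))
        ≈⟨ +-congˡ (sum-cong-≋ {N} (λ i → solve 2 (λ x c →
             (x :- c) :* (x :- c) := x :* x :+ (:- (con (+ 2) :* c) :* x :+ c :* c)) refl (x i) c)) ⟨
      β * (μ * μ) + sum {N} (λ i → (x i - c) * (x i - c)) ∎)
    where
    μ = sum x
    c = β * μ
    x² : Fin N → ℝ
    x² i = x i * x i

  -- The slack is (N - 2) β.
  1≤2[1-β] : ∀ {N β} → 2 ℕ.≤ N → fromℕ N * β ≈ 1# → 1# ≤ 2# * (1# - β)
  1≤2[1-β] {suc (suc n)} {β} _ Nβ≈1 = *-nonneg (0≤fromℕ n) 0≤β ≤-by (begin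
    2# * (1# - β)
      ≈⟨ solve 1 (λ β → con (+ 2) :* (con (+ 1) :- β) := con (+ 1) :+ (con (+ 1) :- con (+ 2) :* β)) refl β ⟩
    1# + (1# - 2# * β)
      ≈⟨ +-congˡ (+-congʳ Nβ≈1) ⟨
    1# + (fromℕ (suc (suc n)) * β - 2# * β)
      ≈⟨ +-congˡ (solve 2 (λ n β → (con (+ 1) :+ (con (+ 1) :+ n)) :* β :- con (+ 2) :* β := n :* β) refl (fromℕ n) β) ⟩
    1# + fromℕ n * β ∎)
    where
    0≤β : 0# ≤ β
    0≤β = *-cancel-nonneg (0<fromℕ (suc n)) (≤.trans 0≤1 (≤.reflexive (sym Nβ≈1)))
  1≤2[1-β] {suc zero} (s≤s ())

  -- With μ the sum of the x i, the products off the diagonal total μ² minus the sum of squares,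
  -- hence at most (1 - β) μ² = γ μ². This regains one factor γ, and γ μ² ≤ 2 γ² μ² because γ ≥ 1/2.
  pairwise-bound-½ : ∀ {N} (x : Vector ℝ N) (s : Fin N → Fin N → ℝ) {β} →
    1# ≤ 2# * (1# - β) → fromℕ N * β ≈ 1# → (∀ i → s i i ≈ x i) →
    (∀ i j → i ≢ j → (1# - β) * (1# - β) * s i j ≤ x i * x j) →
    sum {N} (λ i → sum {N} (s i)) ≤ sum x + 2# * (sum x * sum x)
  pairwise-bound-½ {N} x s {β} 1≤2γ Nβ≈1 sᵢᵢ≈x sᵢⱼ≤ =
    *-cancel-≤ 0<γ² (R≤.begin
      γ * γ * sum {N} (λ i → sum {N} (s i))
        R≤.≈⟨ trans (*-distribˡ-sum {N} (γ * γ) _) (sum-cong-≋ {N} (λ i → *-distribˡ-sum {N} (γ * γ) (s i))) ⟩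
      sum {N} (λ i → sum {N} (λ j → γ * γ * s i j))
        R≤.≤⟨ sum-mono-≤ {N} (λ i → sum-mono-≤ {N} (λ j → termwise i j)) ⟩
      sum {N} (λ i → sum {N} (λ j → x i * x j + δ i j (d i)))
        R≤.≈⟨ sum-cong-≋ {N} (λ i → trans (∑-distrib-+ {N} (λ j → x i * x j) _)
                (+-cong (sym (*-distribˡ-sum {N} (x i) x)) (sum-δ i (d i)))) ⟩
      sum {N} (λ i → x i * μ + (γ * γ * x i + - 1# * (x i * x i)))
        R≤.≈⟨ trans (∑-distrib-+ {N} (λ i → x i * μ) _)
                (+-cong (sym (*-distribʳ-sum {N} μ x)) (trans (∑-distrib-+ {N} (λ i → γ * γ * x i) _)
                  (+-cong (sym (*-distribˡ-sum {N} (γ * γ) x)) (sym (*-distribˡ-sum {N} (- 1#) _))))) ⟩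
      μ * μ + (γ * γ * μ + - 1# * q)
        R≤.≤⟨ +-nonneg (x≤y⇒0≤y-x (mean²≤sum-of-squares x Nβ≈1))
                (*-nonneg (*-nonneg 0≤γ (x≤y⇒0≤y-x 1≤2γ)) (0≤x² μ)) ≤-by
              solve 3 (λ β μ q → let γ = con (+ 1) :- β in
                γ :* γ :* (μ :+ con (+ 2) :* (μ :* μ)) :=
                μ :* μ :+ (γ :* γ :* μ :+ (:- con (+ 1)) :* q)
                  :+ (q :- β :* (μ :* μ) :+ γ :* (con (+ 2) :* γ :- con (+ 1)) :* (μ :* μ))) refl β μ q ⟩
      γ * γ * (μ + 2# * (μ * μ)) R≤.∎)
    where
    γ μ q : ℝ
    γ = 1# - β
    μ = sum x
    q = sum {N} (λ i → x i * x i)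
    -- Exchanges the product `x i * x i` on the diagonal for the true entry γ² x i, so that the
    -- double sum can run over all pairs.
    d : Fin N → ℝ
    d i = γ * γ * x i + - 1# * (x i * x i)

    0≤γ : 0# ≤ γ
    0≤γ = *-cancel-nonneg 0<2 (≤.trans 0≤1 1≤2γ)
    0<γ : 0# < γ
    0<γ = 0≤γ , λ 0≈γ → <⇒≱ 0<1 (≤.trans 1≤2γ (≤.reflexive (trans (*-congˡ (sym 0≈γ)) (zeroʳ _))))
    0<γ² : 0# < γ * γ
    0<γ² = *-pos 0<γ 0<γ

    termwise : ∀ i j → γ * γ * s i j ≤ x i * x j + δ i j (d i)
    termwise i j with i Finₚ.≟ j
    ... | yes ≡.refl = ≤.reflexive (trans (*-congˡ (sᵢᵢ≈x i))
            (solve 2 (λ γ x → γ :* γ :* x := x :* x :+ (γ :* γ :* x :+ (:- con (+ 1)) :* (x :* x))) refl γ (x i)))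
    ... | no  i≢j    = ≤.trans (sᵢⱼ≤ i j i≢j) (≤.reflexive (sym (+-identityʳ _)))

  -- For a single index γ vanishes and cannot be cancelled, but the double sum is then just its
  -- diagonal entry. From two indices on, γ ≥ 1/2.
  pairwise-bound : ∀ {N} (x : Vector ℝ N) (s : Fin N → Fin N → ℝ) {β} →
    fromℕ N * β ≈ 1# → (∀ i → s i i ≈ x i) →
    (∀ i j → i ≢ j → (1# - β) * (1# - β) * s i j ≤ x i * x j) →
    sum {N} (λ i → sum {N} (s i)) ≤ sum x + 2# * (sum x * sum x)
  pairwise-bound {zero} x s Nβ≈1 _ _ = ⊥-elim (0≉1 (trans (sym (zeroˡ _)) Nβ≈1))
  pairwise-bound {suc zero} x s {β} _ sᵢᵢ≈x _ =
    *-nonneg (proj₁ 0<2) (0≤x² (sum x)) ≤-by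
      +-congʳ (sym (trans (+-identityʳ _) (+-congʳ (sᵢᵢ≈x Fin.zero))))
  pairwise-bound {suc (suc n)} x s Nβ≈1 = pairwise-bound-½ x s (1≤2[1-β] {suc (suc n)} (s≤s (s≤s z≤n)) Nβ≈1) Nβ≈1

-- Borel sets and initial segments of the line

module BorelSets (R : Reals) where
  open Reals R
  open OrderedFieldProperties orderedField
  open PowerInequalities R
  open import Relation.Binary.Reasoning.Setoid setoid

  -- Closed rays generate the Borel sets; the open ray is their union along s - 1/(n+1).
  borel-< : ∀ s → Borel (_< s)
  borel-< s = resp-≐ (below , above) (union (λ n → _≤ s - ε n) (λ n → ray (s - ε n)))
    where
    ε : ℕ → ℝ
    ε n = fromℕ (suc n) ⁻¹

    0<ε : ∀ n → 0# < ε n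
    0<ε n = ⁻¹-pos (0<fromℕ n)

    below : ⋃ ℕ (λ n → _≤ s - ε n) ⊆ (_< s)
    below {y} (n , y≤s-ε) = ≰⇒> λ s≤y → <⇒≱ (0<ε n) (x≤y⇒0≤y-x (≤.trans s≤y y≤s-ε) ≤-by
      solve 2 (λ s e → con (+ 0) := e :+ (s :- e :- s)) refl s (ε n))

    above : (_< s) ⊆ ⋃ ℕ (λ n → _≤ s - ε n)
    above {y} y<s with archimedean ((s - y) ⁻¹)
    ... | n , 1/d<n = n , (x≤y⇒0≤y-x ε≤d ≤-by
            solve 3 (λ s y e → s :- e := y :+ (s :- y :- e)) refl s y (ε n))
      where
      d = s - y
      0<d : 0# < d
      0<d = x<y⇒0<y-x y<s
      ε≤d : ε n ≤ d
      ε≤d = *-cancel-≤ (0<fromℕ n) (R≤.begin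
        fromℕ (suc n) * ε n  R≤.≈⟨ trans (⁻¹-inverseʳ (0<fromℕ n)) (sym (⁻¹-inverseʳ 0<d)) ⟩
        d * d ⁻¹             R≤.≤⟨ *-monoˡ-≤ (proj₁ 0<d) (≤.trans (proj₁ 1/d<n)
                                     (fromℕ-mono-≤ (ℕₚ.n≤1+n n))) ⟩
        d * fromℕ (suc n)    R≤.≈⟨ *-comm _ _ ⟩
        fromℕ (suc n) * d    R≤.∎)

  borel-∪ : ∀ {B B′} → Borel B → Borel B′ → Borel (B ∪ B′)
  borel-∪ {B} {B′} B-borel B′-borel = resp-≐
    ( (λ { (0 , b) → inj₁ b ; (suc _ , b) → inj₂ b })
    , (λ { (inj₁ b) → 0 , b ; (inj₂ b) → 1 , b }))
    (union both both-borel)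
    where
    both : ℕ → Pred ℝ 0ℓ
    both zero    = B
    both (suc _) = B′
    both-borel : ∀ k → Borel (both k)
    both-borel zero    = B-borel
    both-borel (suc _) = B′-borel

  borel-∩ : ∀ {B B′} → Decidable B → Decidable B′ → Borel B → Borel B′ → Borel (B ∩ B′)
  borel-∩ B? B′? B-borel B′-borel = resp-≐
    ( (λ {y} y∉ → decidable-stable (B? y) (y∉ ∘ inj₁) , decidable-stable (B′? y) (y∉ ∘ inj₂))
    , (λ (b , b′) → [ (λ ¬b → ¬b b) , (λ ¬b′ → ¬b′ b′) ]))
    (complement (borel-∪ (complement B-borel) (complement B′-borel)))

  -- Keeps only the supremum and whether it is attained. This is enough for measurability and for
  -- the probability, and it hides how logarithm and floor determine the boundary.
  record InitialSegment (D : Pred ℝ 0ℓ) (s : ℝ) : Set where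
    field
      upper   : UpperBound D s
      least   : ∀ b → UpperBound D b → s ≤ b
      closed⊎open : (D ≐ (_≤ s)) ⊎ (D ≐ (_< s))

  initialSegment : ∀ {D} → Decidable D → (∀ {x y} → x ≤ y → D y → D x) →
                   ∃ D → ∃ (UpperBound D) → ∃ (InitialSegment D)
  initialSegment {D} D? down inhabited bounded with complete D inhabited bounded
  ... | s , upper , least = s , record
    { upper = upper ; least = least ; closed⊎open = closed⊎open (D? s) }
    where
    <s⇒D : ∀ {y} → y < s → D y
    <s⇒D {y} y<s with D? y
    ... | yes d  = d
    ... | no  ¬d = ⊥-elim (<⇒≱ y<s (least y (λ z Dz → [ id , (λ y≤z → ⊥-elim (¬d (down y≤z Dz))) ] (≤.total z y))))

    closed⊎open : Dec (D s) → (D ≐ (_≤ s)) ⊎ (D ≐ (_< s))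
    closed⊎open (yes Ds) = inj₁ ((λ {y} → upper y) , (λ y≤s → down y≤s Ds))
    closed⊎open (no ¬Ds) = inj₂
      ( (λ {y} Dy → upper y Dy , λ y≈s → ¬Ds (down (≤.reflexive (sym y≈s)) Dy))
      , <s⇒D)

  borel-initialSegment : ∀ {D s} → InitialSegment D s → Borel D
  borel-initialSegment {s = s} seg with InitialSegment.closed⊎open seg
  ... | inj₁ (D⊆ , ⊆D) = resp-≐ (⊆D , D⊆) (ray s)
  ... | inj₂ (D⊆ , ⊆D) = resp-≐ (⊆D , D⊆) (borel-< s)

-- Hash codes numbered by rank

module Cells (R : Reals) (p q r : ℕ) where
  open Reals R
  open OrderedFieldProperties orderedField
  open HyperMinHash R
  open import Relation.Binary.Reasoning.Setoid setoid

  ⌊⌋-nonneg : ∀ {x} → 0# ≤ x → ⌊ x ⌋ ≡ + ∣ ⌊ x ⌋ ∣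
  ⌊⌋-nonneg {x} 0≤x with ⌊ x ⌋ | ⌊⌋-upper x
  ... | + _      | _     = ≡.refl
  ... | -[1+ n ] | x<-n = ⊥-elim (<⇒≱ x<-n (≤.trans (0≤fromℕ n ≤-by
          solve 1 (λ n → con (+ 0) := (:- (con (+ 1) :+ n)) :+ con (+ 1) :+ n) refl (fromℕ n)) 0≤x))

  ∣⌊⌋∣-lower : ∀ {x} → 0# ≤ x → fromℕ ∣ ⌊ x ⌋ ∣ ≤ x
  ∣⌊⌋∣-lower {x} 0≤x = ≡.subst (λ i → fromℤ i ≤ x) (⌊⌋-nonneg 0≤x) (⌊⌋-lower x)

  ∣⌊⌋∣-upper : ∀ {x} → 0# ≤ x → x < fromℕ (suc ∣ ⌊ x ⌋ ∣)
  ∣⌊⌋∣-upper {x} 0≤x = <-≤-trans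
    (≡.subst (λ i → x < fromℤ i + 1#) (⌊⌋-nonneg 0≤x) (⌊⌋-upper x)) (≤.reflexive (+-comm _ _))

  ∣⌊⌋∣-mono : ∀ {x y} → 0# ≤ x → x ≤ y → ∣ ⌊ x ⌋ ∣ ℕ.≤ ∣ ⌊ y ⌋ ∣
  ∣⌊⌋∣-mono 0≤x x≤y = ℕₚ.≤-pred (fromℕ-cancel-<
    (≤-<-trans (≤.trans (∣⌊⌋∣-lower 0≤x) x≤y) (∣⌊⌋∣-upper (≤.trans 0≤x x≤y))))

  ∣⌊⌋∣-≤ : ∀ {x n} → 0# ≤ x → x ≤ fromℕ n → ∣ ⌊ x ⌋ ∣ ℕ.≤ n
  ∣⌊⌋∣-≤ {x} {n} 0≤x x≤n = ℕₚ.≤-pred (fromℕ-cancel-<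
    (≤-<-trans (≤.trans (∣⌊⌋∣-lower 0≤x) x≤n) (fromℕ-mono-< (ℕₚ.n<1+n n))))

  log₂-1 : log₂ 1# ≈ 0#
  log₂-1 = begin
    log₂ 1#                       ≈⟨ solve 1 (λ l → l := l :+ l :- l) refl (log₂ 1#) ⟩
    log₂ 1# + log₂ 1# - log₂ 1#   ≈⟨ +-congʳ (log₂-* 0<1 0<1) ⟨
    log₂ (1# * 1#) - log₂ 1#      ≈⟨ +-congʳ (log₂-cong (*-identityˡ 1#)) ⟩
    log₂ 1# - log₂ 1#             ≈⟨ -‿inverseʳ _ ⟩
    0#                            ∎

  log₂-2^ : ∀ n → log₂ (2# ^ n) ≈ fromℕ n
  log₂-2^ zero    = log₂-1
  log₂-2^ (suc n) = trans (log₂-* 0<2 (^-pos n 0<2)) (+-cong log₂-2 (log₂-2^ n))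

  log₂-mono-≤ : ∀ {x y} → 0# < x → x ≤ y → log₂ x ≤ log₂ y
  log₂-mono-≤ {x} {y} 0<x x≤y with x ≈? y
  ... | yes x≈y = ≤.reflexive (log₂-cong x≈y)
  ... | no  x≉y = proj₁ (log₂-mono 0<x (x≤y , x≉y))

  log₂-cancel-≤ : ∀ {x y} → 0# < y → log₂ x ≤ log₂ y → x ≤ y
  log₂-cancel-≤ 0<y lx≤ly = ≮⇒≥ λ y<x → <⇒≱ (log₂-mono 0<y y<x) lx≤ly

  module _ {x : ℝ} (0<x : 0# < x) where
    log₂-x2^ : ∀ n → log₂ (x * 2# ^ n) ≈ log₂ x + fromℕ n
    log₂-x2^ n = trans (log₂-* 0<x (^-pos n 0<2)) (+-congˡ (log₂-2^ n))

    x2^≤1 : ∀ n → fromℕ n ≤ - log₂ x → x * 2# ^ n ≤ 1#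
    x2^≤1 n n≤-log = log₂-cancel-≤ 0<1 (≤.trans (≤.reflexive (log₂-x2^ n))
      (≤.trans (x≤y⇒0≤y-x n≤-log ≤-by solve 2 (λ l n → con (+ 0) := l :+ n :+ (:- l :- n)) refl (log₂ x) (fromℕ n))
        (≤.reflexive (sym log₂-1))))

    1≤x2^ : ∀ n → - log₂ x ≤ fromℕ n → 1# ≤ x * 2# ^ n
    1≤x2^ n -log≤n = log₂-cancel-≤ (*-pos 0<x (^-pos n 0<2)) (≤.trans (≤.reflexive log₂-1)
      (≤.trans (x≤y⇒0≤y-x -log≤n ≤-by solve 2 (λ l n → l :+ n := con (+ 0) :+ (n :- (:- l))) refl (log₂ x) (fromℕ n))
        (≤.reflexive (sym (log₂-x2^ n)))))

  Q S ranks : ℕ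
  Q = 2 ℕ.^ q
  S = suc (2 ℕ.^ r)
  ranks = Q ℕ.* S

  -- The hash values in increasing order of the preimage.  S has one more
  -- element than the 2 ^ r mantissas because ĥ produces the mantissa 2 ^ r
  -- at the powers of two.
  rank : ℕ × ℤ → ℕ
  rank (c , j) = (Q ℕ.∸ c) ℕ.* S ℕ.+ ∣ j ∣

  private
    -- The real number whose floor is the second component of the hash code, for either branch of
    -- `ĥ`.
    mantissa : ℕ → ℝ → ℝ
    mantissa c x with c ℕₚ.<? Q
    ... | yes _ = (x * 2# ^ c - 1#) * 2# ^ r
    ... | no  _ = x * 2# ^ (Q ℕ.∸ 1) * 2# ^ r

    record IsCode (x : ℝ) (v : ℕ × ℤ) : Set where
      field
        exponent   : proj₁ v ≡ ρ q x
        1≤exponent : 1 ℕ.≤ proj₁ v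
        exponent≤Q : proj₁ v ℕ.≤ Q
        bounded    : ∣ proj₂ v ∣ ℕ.< S
        nonneg     : 0# ≤ mantissa (proj₁ v) x
        floor      : proj₂ v ≡ ⌊ mantissa (proj₁ v) x ⌋

    0≤2^r : 0# ≤ 2# ^ r
    0≤2^r = ^-nonneg r (proj₁ 0<2)

    2^r≈ : ∀ {y} → y ≤ 1# → y * 2# ^ r ≤ fromℕ (2 ℕ.^ r)
    2^r≈ {y} y≤1 = ≤.trans (*-monoʳ-≤ 0≤2^r y≤1)
      (≤.reflexive (trans (*-identityˡ _) (sym (fromℕ-2^ r))))

  module _ {x : ℝ} (0<x : 0# < x) (x<1 : x < 1#) where
    private
      L : ℕ
      L = ∣ ⌊ - log₂ x ⌋ ∣

      0≤-log : 0# ≤ - log₂ x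
      0≤-log = ≤.trans (≤.reflexive (solve 0 (con (+ 0) := :- con (+ 0)) refl))
        (neg-mono-≤ (≤.trans (log₂-mono-≤ 0<x (proj₁ x<1)) (≤.reflexive log₂-1)))

      1≤ρ : 1 ℕ.≤ ρ q x
      1≤ρ = ℕₚ.⊓-glb (ℕₚ.m≤n+m 1 L) (ℕₚ.m^n>0 2 q)

      mantissa-< : ∀ {c} → c ℕ.< Q → mantissa c x ≡ (x * 2# ^ c - 1#) * 2# ^ r
      mantissa-< {c} c<Q with c ℕₚ.<? Q
      ... | yes _   = ≡.refl
      ... | no  c≮Q = ⊥-elim (c≮Q c<Q)

      mantissa-Q : mantissa Q x ≡ x * 2# ^ (Q ℕ.∸ 1) * 2# ^ r
      mantissa-Q with Q ℕₚ.<? Q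
      ... | yes Q<Q = ⊥-elim (ℕₚ.<-irrefl ≡.refl Q<Q)
      ... | no  _   = ≡.refl

    ĥ-isCode : IsCode x (ĥ q r x)
    ĥ-isCode with ρ q x ℕₚ.<? Q
    ... | yes ρ<Q = record
      { exponent   = ≡.refl
      ; 1≤exponent = 1≤ρ
      ; exponent≤Q = ℕₚ.<⇒≤ ρ<Q
      ; bounded    = s≤s (∣⌊⌋∣-≤ 0≤m m≤2^r)
      ; nonneg     = ≤.trans 0≤m (≤.reflexive (reflexive (≡.sym (mantissa-< ρ<Q))))
      ; floor      = ≡.cong ⌊_⌋ (≡.sym (mantissa-< ρ<Q))
      }
      where
      ρ≡1+L : ρ q x ≡ suc L
      ρ≡1+L with ℕₚ.⊓-sel (L ℕ.+ 1) Q
      ... | inj₁ ρ≡L+1 = ≡.trans ρ≡L+1 (ℕₚ.+-comm L 1)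
      ... | inj₂ ρ≡Q   = ⊥-elim (ℕₚ.<-irrefl ρ≡Q ρ<Q)
      -- From L ≤ - log₂ x < L + 1 and ρ = L + 1, the scaled value lies between 1 and 2.
      1≤x2^ρ : 1# ≤ x * 2# ^ ρ q x
      1≤x2^ρ = ≡.subst (λ c → 1# ≤ x * 2# ^ c) (≡.sym ρ≡1+L) (1≤x2^ 0<x (suc L) (proj₁ (∣⌊⌋∣-upper 0≤-log)))
      x2^ρ≤2 : x * 2# ^ ρ q x ≤ 1# + 1#
      x2^ρ≤2 = ≡.subst (λ c → x * 2# ^ c ≤ 1# + 1#) (≡.sym ρ≡1+L) (≤.trans
        (≤.reflexive (solve 2 (λ x e → x :* (con (+ 2) :* e) := x :* e :+ x :* e) refl x (2# ^ L)))
        (+-mono-≤ x2^L≤1 x2^L≤1))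
        where x2^L≤1 = x2^≤1 0<x L (∣⌊⌋∣-lower 0≤-log)
      0≤m : 0# ≤ (x * 2# ^ ρ q x - 1#) * 2# ^ r
      0≤m = *-nonneg (x≤y⇒0≤y-x 1≤x2^ρ) 0≤2^r
      m≤2^r : (x * 2# ^ ρ q x - 1#) * 2# ^ r ≤ fromℕ (2 ℕ.^ r)
      m≤2^r = 2^r≈ (≤.trans (+-monoˡ-≤ (- 1#) x2^ρ≤2)
        (≤.reflexive (solve 0 (con (+ 1) :+ con (+ 1) :- con (+ 1) := con (+ 1)) refl)))
    -- At the cut-off only L ≥ Q - 1 is known, so the scaled value ranges over [0,1] and no 1 is
    -- subtracted.
    ... | no  ρ≮Q = record
      { exponent   = ≡.sym ρ≡Q
      ; 1≤exponent = ℕₚ.m^n>0 2 q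
      ; exponent≤Q = ℕₚ.≤-refl
      ; bounded    = s≤s (∣⌊⌋∣-≤ 0≤m (2^r≈ (x2^≤1 0<x (Q ℕ.∸ 1)
                       (≤.trans (fromℕ-mono-≤ Q∸1≤L) (∣⌊⌋∣-lower 0≤-log)))))
      ; nonneg     = ≤.trans 0≤m (≤.reflexive (reflexive (≡.sym mantissa-Q)))
      ; floor      = ≡.cong ⌊_⌋ (≡.sym mantissa-Q)
      }
      where
      ρ≡Q : ρ q x ≡ Q
      ρ≡Q = ℕₚ.≤-antisym (ℕₚ.m⊓n≤n (L ℕ.+ 1) Q) (ℕₚ.≮⇒≥ ρ≮Q)
      Q∸1≤L : Q ℕ.∸ 1 ℕ.≤ L
      Q∸1≤L = ℕₚ.m≤n+o⇒m∸n≤o Q 1 (ℕₚ.≤-trans (ℕₚ.m⊓n≡n⇒n≤m ρ≡Q) (ℕₚ.≤-reflexive (ℕₚ.+-comm L 1)))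
      0≤m : 0# ≤ x * 2# ^ (Q ℕ.∸ 1) * 2# ^ r
      0≤m = *-nonneg (*-nonneg (proj₁ 0<x) (^-nonneg (Q ℕ.∸ 1) (proj₁ 0<2))) 0≤2^r

  module _ {x : ℝ} (0<x : 0# < x) (x<1 : x < 1#) where
    private module X = IsCode (ĥ-isCode 0<x x<1)

    rank<ranks : rank (ĥ q r x) ℕ.< ranks
    rank<ranks = ℕₚ.<-≤-trans (ℕₚ.+-monoʳ-< ((Q ℕ.∸ c) ℕ.* S) X.bounded)
      (ℕₚ.≤-trans (ℕₚ.≤-reflexive (ℕₚ.+-comm ((Q ℕ.∸ c) ℕ.* S) S))
        (ℕₚ.*-monoˡ-≤ S (ℕₚ.∸-monoʳ-< X.1≤exponent X.exponent≤Q)))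
      where c = proj₁ (ĥ q r x)

    module _ {y : ℝ} (y<1 : y < 1#) where

      -- A larger argument has a smaller or equal exponent; for equal exponents the floors decide.
      -- Because of this the least hash value has the least rank, and the cells below a given rank
      -- form an initial segment.
      rank-mono : x ≤ y → rank (ĥ q r x) ℕ.≤ rank (ĥ q r y)
      rank-mono x≤y = compare (ℕₚ.m≤n⇒m<n∨m≡n cy≤cx)
        where
        0<y = <-≤-trans 0<x x≤y
        module Y = IsCode (ĥ-isCode 0<y y<1)
        cx = proj₁ (ĥ q r x)
        cy = proj₁ (ĥ q r y)

        0≤-log-y : 0# ≤ - log₂ y
        0≤-log-y = ≤.trans (≤.reflexive (solve 0 (con (+ 0) := :- con (+ 0)) refl))
          (neg-mono-≤ (≤.trans (log₂-mono-≤ 0<y (proj₁ y<1)) (≤.reflexive log₂-1)))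

        cy≤cx : cy ℕ.≤ cx
        cy≤cx = ≡.subst₂ ℕ._≤_ (≡.sym Y.exponent) (≡.sym X.exponent) (ℕₚ.⊓-monoˡ-≤ Q (ℕₚ.+-monoˡ-≤ 1
          (∣⌊⌋∣-mono 0≤-log-y (neg-mono-≤ (log₂-mono-≤ 0<x x≤y)))))

        mantissa-mono : ∀ c → mantissa c x ≤ mantissa c y
        mantissa-mono c with c ℕₚ.<? Q
        ... | yes _ = *-monoʳ-≤ 0≤2^r (+-monoˡ-≤ (- 1#) (*-monoʳ-≤ (^-nonneg c (proj₁ 0<2)) x≤y))
        ... | no  _ = *-monoʳ-≤ 0≤2^r (*-monoʳ-≤ (^-nonneg (Q ℕ.∸ 1) (proj₁ 0<2)) x≤y)

        compare : cy ℕ.< cx ⊎ cy ≡ cx → rank (ĥ q r x) ℕ.≤ rank (ĥ q r y)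
        -- A smaller exponent shifts the rank by at least one block of length `S`, more than the
        -- second component can make up for.
        compare (inj₁ cy<cx) = ℕₚ.<⇒≤ (ℕₚ.<-≤-trans
          (ℕₚ.+-monoʳ-< ((Q ℕ.∸ cx) ℕ.* S) X.bounded)
          (ℕₚ.≤-trans (ℕₚ.≤-reflexive (ℕₚ.+-comm ((Q ℕ.∸ cx) ℕ.* S) S))
            (ℕₚ.≤-trans (ℕₚ.*-monoˡ-≤ S (ℕₚ.∸-monoʳ-< cy<cx X.exponent≤Q)) (ℕₚ.m≤m+n _ _))))
        compare (inj₂ cy≡cx) = ℕₚ.+-mono-≤
          (ℕₚ.≤-reflexive (≡.cong (λ c → (Q ℕ.∸ c) ℕ.* S) (≡.sym cy≡cx)))
          (≡.subst₂ ℕ._≤_ (≡.cong ∣_∣ (≡.sym X.floor))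
            (≡.cong ∣_∣ (≡.trans (≡.cong (λ c → ⌊ mantissa c y ⌋) (≡.sym cy≡cx)) (≡.sym Y.floor)))
            (∣⌊⌋∣-mono X.nonneg (mantissa-mono cx)))

      -- Uniqueness of quotient and remainder modulo `S`; nonnegativity of the floors recovers them
      -- from their absolute values. Collisions may thus be read off from ranks.
      rank-injective : 0# < y → rank (ĥ q r x) ≡ rank (ĥ q r y) → ĥ q r x ≡ ĥ q r y
      rank-injective 0<y rx≡ry = ≡.cong₂ _,_ cx≡cy (≡.trans jx≡ (≡.trans (≡.cong +_ ∣j∣≡) (≡.sym jy≡)))
        where
        module Y = IsCode (ĥ-isCode 0<y y<1)
        vx = ĥ q r x
        vy = ĥ q r y
        divide : ∀ a b {i j} → i ℕ.< S → j ℕ.< S → a ℕ.* S ℕ.+ i ≡ b ℕ.* S ℕ.+ j → a ≡ b × i ≡ j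
        divide zero    zero    _ _ i≡j = ≡.refl , i≡j
        divide zero    (suc b) i<S _ eq = ⊥-elim (ℕₚ.<⇒≱ i<S (ℕₚ.≤-trans (ℕₚ.m≤m+n S _)
          (ℕₚ.≤-reflexive (≡.trans (≡.sym (ℕₚ.+-assoc S (b ℕ.* S) _)) (≡.sym eq)))))
        divide (suc a) zero    _ j<S eq = ⊥-elim (ℕₚ.<⇒≱ j<S (ℕₚ.≤-trans (ℕₚ.m≤m+n S _)
          (ℕₚ.≤-reflexive (≡.trans (≡.sym (ℕₚ.+-assoc S (a ℕ.* S) _)) eq))))
        divide (suc a) (suc b) i<S j<S eq with divide a b i<S j<S (ℕₚ.+-cancelˡ-≡ S _ _
          (≡.trans (≡.sym (ℕₚ.+-assoc S (a ℕ.* S) _)) (≡.trans eq (ℕₚ.+-assoc S (b ℕ.* S) _))))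
        ... | a≡b , i≡j = ≡.cong suc a≡b , i≡j
        quotient,remainder = divide (Q ℕ.∸ proj₁ vx) (Q ℕ.∸ proj₁ vy) X.bounded Y.bounded rx≡ry
        cx≡cy : proj₁ vx ≡ proj₁ vy
        cx≡cy = ℕₚ.∸-cancelˡ-≡ X.exponent≤Q Y.exponent≤Q (proj₁ quotient,remainder)
        ∣j∣≡ = proj₂ quotient,remainder
        jx≡ : proj₂ vx ≡ + ∣ proj₂ vx ∣
        jx≡ = ≡.subst (λ j → j ≡ + ∣ j ∣) (≡.sym X.floor) (⌊⌋-nonneg X.nonneg)
        jy≡ : proj₂ vy ≡ + ∣ proj₂ vy ∣
        jy≡ = ≡.subst (λ j → j ≡ + ∣ j ∣) (≡.sym Y.floor) (⌊⌋-nonneg Y.nonneg)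

-- Buckets and the ranks of their minima

module Buckets (R : Reals) (p q r : ℕ) where
  open Reals R
  open OrderedFieldProperties orderedField
  open BorelSets R
  open Cells R p q r
  open HyperMinHash R

  K : ℕ
  K = 2 ℕ.^ p

  T β : ℝ
  T = 2# ^ p
  β = T ⁻¹

  0<T : 0# < T
  0<T = ^-pos p 0<2

  0≤β : 0# ≤ β
  0≤β = ⁻¹-nonneg 0<T

  Kβ≈1 : fromℕ K * β ≈ 1#
  Kβ≈1 = trans (*-congʳ (fromℕ-2^ p)) (⁻¹-inverseʳ 0<T)

  module _ (i : Fin K) where
    lo hi : ℝ
    lo = fromℕ (toℕ i) * β
    hi = fromℕ (suc (toℕ i)) * β

    hi≈lo+β : hi ≈ lo + β
    hi≈lo+β = solve 2 (λ i β → (con (+ 1) :+ i) :* β := i :* β :+ β) refl (fromℕ (toℕ i)) β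

    0≤lo : 0# ≤ lo
    0≤lo = *-nonneg (0≤fromℕ (toℕ i)) 0≤β

    lo≤hi : lo ≤ hi
    lo≤hi = 0≤β ≤-by hi≈lo+β

    hi≤1 : hi ≤ 1#
    hi≤1 = ≤.trans (*-monoʳ-≤ 0≤β (fromℕ-mono-≤ (Finₚ.toℕ<n i))) (≤.reflexive Kβ≈1)

    scaled : ℝ → ℝ
    scaled y = y * T - fromℕ (toℕ i)

    private
      T*[nβ] : ∀ n → T * (fromℕ n * β) ≈ fromℕ n
      T*[nβ] n = trans (solve 3 (λ t n b → t :* (n :* b) := n :* (t :* b)) refl T (fromℕ n) β)
        (trans (*-congˡ (⁻¹-inverseʳ 0<T)) (*-identityʳ _))

    0<scaled : ∀ {y} → lo < y → 0# < scaled y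
    0<scaled {y} lo<y = x<y⇒0<y-x (≤-<-trans (≤.reflexive (sym (T*[nβ] (toℕ i))))
      (<-≤-trans (*-mono-< 0<T lo<y) (≤.reflexive (*-comm _ _))))

    scaled<1 : ∀ {y} → y < hi → scaled y < 1#
    scaled<1 {y} y<hi = 0<y-x⇒x<y (<-≤-trans (x<y⇒0<y-x (≤-<-trans (≤.reflexive (*-comm y T))
        (<-≤-trans (*-mono-< 0<T y<hi) (≤.reflexive (T*[nβ] (suc (toℕ i)))))))
      (≤.reflexive (solve 2 (λ i y → con (+ 1) :+ i :- y := con (+ 1) :- (y :- i)) refl (fromℕ (toℕ i)) (y * T))))

    scaled-mono : ∀ {x y} → x ≤ y → scaled x ≤ scaled y
    scaled-mono x≤y = +-monoˡ-≤ _ (*-monoʳ-≤ (proj₁ 0<T) x≤y)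

    bucketRank : ℝ → ℕ
    bucketRank y = rank (ĥ q r (scaled y))

    module _ (k : ℕ) where
      Below : Pred ℝ 0ℓ
      Below y = InBucket p i y × bucketRank y ℕ.< k

      below? : Decidable Below
      below? y = inBucket? p i y ×-dec (bucketRank y ℕₚ.<? k)

      -- Adjoining the ray up to `lo` makes the set downward closed and inhabited, so that it has a
      -- supremum even if `Below` is empty.
      Segment : Pred ℝ 0ℓ
      Segment = (_≤ lo) ∪ Below

      segment? : Decidable Segment
      segment? y = (y ≤? lo) ⊎-dec below? y

      segment≤hi : UpperBound Segment hi
      segment≤hi y = [ (λ y≤lo → ≤.trans y≤lo lo≤hi) , (λ ((_ , y<hi) , _) → proj₁ y<hi) ]

      segment-down : ∀ {x y} → x ≤ y → Segment y → Segment x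
      segment-down x≤y (inj₁ y≤lo) = inj₁ (≤.trans x≤y y≤lo)
      segment-down {x} {y} x≤y (inj₂ ((lo<y , y<hi) , rank<k)) with x ≤? lo
      ... | yes x≤lo = inj₁ x≤lo
      ... | no  x≰lo = inj₂ ((≰⇒> x≰lo , ≤-<-trans x≤y y<hi) ,
        ℕₚ.≤-<-trans (rank-mono (0<scaled (≰⇒> x≰lo)) (scaled<1 (≤-<-trans x≤y y<hi)) (scaled<1 y<hi)
          (scaled-mono x≤y)) rank<k)

      segment : ∃ (InitialSegment Segment)
      segment = initialSegment segment? segment-down (lo , inj₁ ≤.refl) (hi , segment≤hi)

      end : ℝ
      end = proj₁ segment

      open InitialSegment (proj₂ segment)

      lo≤end : lo ≤ end
      lo≤end = upper lo (inj₁ ≤.refl)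

      end≤hi : end ≤ hi
      end≤hi = least hi segment≤hi

      below : Segment ∩ ∁ (_≤ lo) ≐ Below
      below = (λ { (inj₁ y≤lo , y≰lo) → ⊥-elim (y≰lo y≤lo) ; (inj₂ b , _) → b })
            , (λ b → inj₂ b , <⇒≱ (proj₁ (proj₁ b)))

      borel-Below : Borel Below
      borel-Below = resp-≐ below (borel-∩ segment? (λ y → ¬? (y ≤? lo))
        (borel-initialSegment (proj₂ segment)) (complement (ray lo)))

      -- The probability that a hash value lies in Below.
      mass : ℝ
      mass = end - lo

      0≤mass : 0# ≤ mass
      0≤mass = x≤y⇒0≤y-x lo≤end

      mass≤β : mass ≤ β
      mass≤β = ≤.trans (+-monoˡ-≤ (- lo) end≤hi) (≤.reflexive (trans (+-congʳ hi≈lo+β)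
        (solve 2 (λ l b → l :+ b :- l := b) refl lo β)))

    mass-mono : ∀ k → mass k ≤ mass (suc k)
    mass-mono k = +-monoˡ-≤ (- lo) (InitialSegment.least (proj₂ (segment k)) (end (suc k)) λ y →
      [ (λ y≤lo → ≤.trans y≤lo (lo≤end (suc k)))
      , (λ (b , r<k) → InitialSegment.upper (proj₂ (segment (suc k))) y (inj₂ (b , ℕₚ.m<n⇒m<1+n r<k))) ])

  buckets-disjoint : ∀ {i j y} → i ≢ j → InBucket p i y → ¬ InBucket p j y
  buckets-disjoint {i} {j} {y} i≢j (lo<y , y<hi) (lo′<y , y<hi′) with ℕₚ.<-cmp (toℕ i) (toℕ j)
  ... | tri< i<j _ _ = <⇒≱ y<hi  (≤.trans (*-monoʳ-≤ 0≤β (fromℕ-mono-≤ i<j)) (proj₁ lo′<y))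
  ... | tri≈ _ i≡j _ = i≢j (Finₚ.toℕ-injective i≡j)
  ... | tri> _ _ j<i = <⇒≱ y<hi′ (≤.trans (*-monoʳ-≤ 0≤β (fromℕ-mono-≤ j<i)) (proj₁ lo<y))

  minimum-just : ∀ xs {x} → minimum xs ≡ just x → x ∈ˡ xs × (∀ {y} → y ∈ˡ xs → x ≤ y)
  minimum-just (x ∷ xs) ≡.refl = min∈ (Extrema.argmin-sel totalOrder id x xs) , min≤
    where
    min∈ : (Extrema.min totalOrder x xs ≡ x) ⊎ (Extrema.min totalOrder x xs ∈ˡ xs) →
           Extrema.min totalOrder x xs ∈ˡ x ∷ xs
    min∈ (inj₁ min≡x) = here min≡x
    min∈ (inj₂ min∈)  = there min∈
    min≤ : ∀ {y} → y ∈ˡ x ∷ xs → Extrema.min totalOrder x xs ≤ y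
    min≤ (here ≡.refl) = Extrema.min≤⊤ totalOrder x xs
    min≤ (there y∈xs)  = All.lookup (Extrema.min≤xs totalOrder x xs) y∈xs

  -- The collision indicator in terms of ranks. The bound rules out two empty buckets, which share
  -- the default rank `ranks` but do not collide.
  agree : ℕ → ℕ → ℕ
  agree a b with (a ℕₚ.≟ b) ×-dec (a ℕₚ.<? ranks)
  ... | yes _ = 1
  ... | no  _ = 0

  agree≡1⇒ : ∀ a b → agree a b ≡ 1 → a ≡ b × a ℕ.< ranks
  agree≡1⇒ a b agree≡1 with (a ℕₚ.≟ b) ×-dec (a ℕₚ.<? ranks)
  ... | yes eq = eq
  ... | no  _  = ⊥-elim (ℕₚ.0≢1+n agree≡1)

  agree-yes : ∀ {a b} → a ≡ b → a ℕ.< ranks → agree a b ≡ 1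
  agree-yes {a} {b} a≡b a<ranks with (a ℕₚ.≟ b) ×-dec (a ℕₚ.<? ranks)
  ... | yes _ = ≡.refl
  ... | no  ¬eq = ⊥-elim (¬eq (a≡b , a<ranks))

  agree-no : ∀ {a b} → ¬ (a ≡ b × a ℕ.< ranks) → agree a b ≡ 0
  agree-no {a} {b} ¬eq with (a ℕₚ.≟ b) ×-dec (a ℕₚ.<? ranks)
  ... | yes eq = ⊥-elim (¬eq eq)
  ... | no  _  = ≡.refl

  module _ {𝕊 : Set} (h : 𝕊 → ℝ) (i : Fin K) where

    -- Empty buckets get the rank following all possible ones.
    bucketMin : List 𝕊 → ℕ
    bucketMin A = maybe rank ranks (f h p q r A i)

    -- Minimality is stated for ranks instead of hash values, since the tails of `bucketMin` depend
    -- on nothing else.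
    data MinView (A : List 𝕊) : Maybe (ℕ × ℤ) → Set where
      empty    : (∀ a → a ∈ˡ A → ¬ InBucket p i (h a)) → MinView A nothing
      attained : ∀ a → a ∈ˡ A → InBucket p i (h a) →
                 (∀ b → b ∈ˡ A → InBucket p i (h b) → bucketRank i (h a) ℕ.≤ bucketRank i (h b)) →
                 MinView A (just (ĥ q r (scaled i (h a))))

    minView : ∀ A → MinView A (f h p q r A i)
    minView A with minimum (map (λ a → h a * T - fromℕ (toℕ i)) (filter (λ a → inBucket? p i (h a)) A)) in eq
    ... | nothing = empty λ a a∈A a∈i → ¬∈nil (∈-map⁺ _ (∈-filter⁺ (λ a → inBucket? p i (h a)) a∈A a∈i)) eq
      where
      ¬∈nil : ∀ {x xs} → x ∈ˡ xs → minimum xs ≢ nothing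
      ¬∈nil (here _)  ()
      ¬∈nil (there _) ()
    ... | just x with minimum-just _ eq
    ...   | x∈ , x≤ with ∈-map⁻ _ x∈
    ...     | a , a∈ , ≡.refl with ∈-filter⁻ (λ a → inBucket? p i (h a)) a∈
    ...       | a∈A , a∈i = attained a a∈A a∈i λ b b∈A b∈i →
                  rank-mono (0<scaled i (proj₁ a∈i)) (scaled<1 i (proj₂ a∈i)) (scaled<1 i (proj₂ b∈i))
                    (x≤ (∈-map⁺ _ (∈-filter⁺ (λ a → inBucket? p i (h a)) b∈A b∈i)))

    bucketMin≤ranks : ∀ A → bucketMin A ℕ.≤ ranks
    bucketMin≤ranks A with f h p q r A i | minView A
    ... | _ | empty _              = ℕₚ.≤-refl
    ... | _ | attained a _ a∈i _   = ℕₚ.<⇒≤ (rank<ranks (0<scaled i (proj₁ a∈i)) (scaled<1 i (proj₂ a∈i)))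

    -- With its converse, this turns a tail of the minimum into a condition on each element
    -- separately, as independence requires. `k ≤ ranks` settles the empty bucket.
    bucketMin-≥⁺ : ∀ {k} A → k ℕ.≤ ranks → (∀ a → a ∈ˡ A → ¬ Below i k (h a)) → k ℕ.≤ bucketMin A
    bucketMin-≥⁺ A k≤ranks ≮k with f h p q r A i | minView A
    ... | _ | empty _              = k≤ranks
    ... | _ | attained a a∈A a∈i _ = ℕₚ.≮⇒≥ (λ <k → ≮k a a∈A (a∈i , <k))

    bucketMin-≥⁻ : ∀ {k} A → k ℕ.≤ bucketMin A → ∀ a → a ∈ˡ A → ¬ Below i k (h a)
    bucketMin-≥⁻ A k≤ a a∈A (a∈i , <k) with f h p q r A i | minView A
    ... | _ | empty ∉i             = ∉i a a∈A a∈i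
    ... | _ | attained _ _ _ least = ℕₚ.<⇒≱ <k (ℕₚ.≤-trans k≤ (least a a∈A a∈i))

    Z≡agree : ∀ A B → Z h p q r A B i ≡ agree (bucketMin A) (bucketMin B)
    Z≡agree A B with f h p q r A i | minView A | f h p q r B i | minView B
    ... | _ | empty _ | _ | _ = ≡.sym (agree-no λ (_ , <ranks) → ℕₚ.<-irrefl ≡.refl <ranks)
    ... | _ | attained _ _ _ _ | _ | empty _ =
      ≡.sym (agree-no λ (≡ranks , <ranks) → ℕₚ.<-irrefl ≡ranks <ranks)
    ... | _ | attained a _ (lo<a , a<hi) _ | _ | attained b _ (lo<b , b<hi) _
      with ĥ q r (scaled i (h a)) ≟ᵛ ĥ q r (scaled i (h b))
    ...   | yes u≡v = ≡.sym (agree-yes (≡.cong rank u≡v) (rank<ranks (0<scaled i lo<a) (scaled<1 i a<hi)))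
    ...   | no  u≢v = ≡.sym (agree-no λ (ranks≡ , _) →
              u≢v (rank-injective (0<scaled i lo<a) (scaled<1 i a<hi) (scaled<1 i b<hi) (0<scaled i lo<b) ranks≡))

-- Uniformity and independence for lists of elements

module RandomHashing {R : Reals} {P : ProbabilitySpace R} {𝕊 : Set}
  {h : 𝕊 → ProbabilitySpace.Ω P → Reals.ℝ R} (H : IsRandomHash P h) where
  open Reals R
  open OrderedFieldProperties orderedField
  open PowerInequalities R
  open BorelSets R
  open ProbabilitySpace P
  open FiniteProbability P
  open IsRandomHash H renaming (measurable to h-measurable)
  open import Relation.Binary.Reasoning.Setoid setoid

  event-h : ∀ a {B} → Decidable B → Borel B → IsEvent (h a ⊢ B)
  event-h a B? B-borel = event (λ ω → B? (h a ω)) (h-measurable a B-borel)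

  -- Uniformity speaks of closed rays only. Were the open ray at s less probable than s, the closed
  -- ray up to the midpoint `t` would be more probable than the open ray containing it.
  ℙ-initialSegment : ∀ {D s} → InitialSegment D s → 0# ≤ s → s ≤ 1# → ∀ a → ℙ (h a ⊢ D) ≈ s
  ℙ-initialSegment {D} {s} D-seg 0≤s s≤1 a with InitialSegment.closed⊎open D-seg
  ... | inj₁ (D⊆ , ⊆D) = trans (ℙ-≐ (D⊆ , ⊆D)) (uniform a s 0≤s s≤1)
  ... | inj₂ (D⊆ , ⊆D) = trans (ℙ-≐ (D⊆ , ⊆D)) (≤.antisym
          (≤.trans (ℙ-mono <s-event (≤-event s) proj₁) (≤.reflexive (uniform a s 0≤s s≤1)))
          (≮⇒≥ λ ℙ<s → <⇒≱ (<mid ℙ<s) (≤.trans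
            (≤.reflexive (sym (uniform a t
              (≤.trans (ℙ-nonneg (measurable <s-event)) (proj₁ (<mid ℙ<s)))
              (≤.trans (proj₁ (mid< ℙ<s)) s≤1))))
            (ℙ-mono (≤-event t) <s-event (λ ≤t → ≤-<-trans ≤t (mid< ℙ<s))))))
    where
    <s-event : IsEvent (h a ⊢ (_< s))
    <s-event = event-h a (_<? s) (borel-< s)
    ≤-event : ∀ t → IsEvent (h a ⊢ (_≤ t))
    ≤-event t = event-h a (_≤? t) (ray t)
    t : ℝ
    t = mid s (ℙ (h a ⊢ (_< s)))

  On : List 𝕊 → Pred ℝ 0ℓ → Pred Ω 0ℓ
  On A G ω = ∀ a → a ∈ˡ A → G (h a ω)

  event-On : ∀ A {G} → Decidable G → Borel G → IsEvent (On A G)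
  event-On []      G? G-borel = event-≐ ((λ _ _ ()) , λ _ → tt) event-U
  event-On (a ∷ A) G? G-borel = event-≐
    ( (λ { (g , _) _ (here ≡.refl) → g ; (_ , gs) b (there b∈A) → gs b b∈A })
    , (λ gs → gs a (here ≡.refl) , λ b b∈A → gs b (there b∈A)))
    (event-∩ (event-h a G? G-borel) (event-On A G? G-borel))

  private
    -- Every element carries its own Borel set, so that one family can impose different conditions
    -- on `A` and on `B`.
    Tagged : Set₁
    Tagged = 𝕊 × Pred ℝ 0ℓ

    hit : Tagged → Pred Ω 0ℓ
    hit (a , G) = h a ⊢ G

    _with-tag_ : List 𝕊 → Pred ℝ 0ℓ → List Tagged
    A with-tag G = map (_, G) A

    lookup-injective : ∀ {xs : List Tagged} → AllPairs (_≢_ on proj₁) xs →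
                       Injective _≡_ _≡_ (proj₁ ∘ lookup xs)
    lookup-injective (_ ∷ _)    {Fin.zero}  {Fin.zero}  _  = ≡.refl
    lookup-injective (x≢ ∷ _)   {Fin.zero}  {Fin.suc j} eq = ⊥-elim (All.lookup x≢ (∈-lookup j) eq)
    lookup-injective (x≢ ∷ _)   {Fin.suc i} {Fin.zero}  eq = ⊥-elim (All.lookup x≢ (∈-lookup i) (≡.sym eq))
    lookup-injective (_ ∷ xs!)  {Fin.suc i} {Fin.suc j} eq = ≡.cong Fin.suc (lookup-injective xs! eq)

    product-tagged : ∀ A G {g} → (∀ a → ℙ (h a ⊢ G) ≈ g) → ∀ L →
      product (λ i → ℙ (hit (lookup (A with-tag G ++ L) i)))
        ≈ g ^ length A * product (λ i → ℙ (hit (lookup L i)))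
    product-tagged []      G g≈ L = sym (*-identityˡ _)
    product-tagged (a ∷ A) G g≈ L = trans (*-cong (g≈ a) (product-tagged A G g≈ L)) (sym (*-assoc _ _ _))

    all-hits : ∀ L {ω} → (∀ i → hit (lookup L i) ω) → All (λ x → hit x ω) L
    all-hits []      _    = []
    all-hits (_ ∷ L) hits = hits Fin.zero ∷ all-hits L (hits ∘ Fin.suc)

  -- Without repetitions and common elements the concatenated list is an injective family, to which
  -- independence applies at once.
  ℙ-On-∩ : ∀ {A B G G′ g g′} → Unique A → Unique B → Disjoint A B → Borel G → Borel G′ →
    (∀ a → ℙ (h a ⊢ G) ≈ g) → (∀ a → ℙ (h a ⊢ G′) ≈ g′) →
    ℙ (On A G ∩ On B G′) ≈ g ^ length A * g′ ^ length B
  ℙ-On-∩ {A} {B} {G} {G′} {g} {g′} A! B! A#B G-borel G′-borel g≈ g′≈ = begin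
    ℙ (On A G ∩ On B G′)
      ≈⟨ ℙ-≐ (all⇒ , ⇒all) ⟩
    ℙ (λ ω → ∀ i → hit (lookup L i) ω)
      ≈⟨ independent (proj₁ ∘ lookup L) (lookup-injective L!) (proj₂ ∘ lookup L)
           (λ i → All.lookup L-borel (∈-lookup i)) ⟩
    product (λ i → ℙ (hit (lookup L i)))
      ≈⟨ product-tagged A G g≈ _ ⟩
    g ^ length A * product (λ i → ℙ (hit (lookup (B with-tag G′ ++ []) i)))
      ≈⟨ *-congˡ (trans (product-tagged B G′ g′≈ []) (*-identityʳ _)) ⟩
    g ^ length A * g′ ^ length B ∎
    where
    L : List Tagged
    L = A with-tag G ++ B with-tag G′ ++ []

    L-borel : All (Borel ∘ proj₂) L
    L-borel = Allₚ.++⁺ (Allₚ.map⁺ (All.universal (λ _ → G-borel) A))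
      (Allₚ.++⁺ (Allₚ.map⁺ (All.universal (λ _ → G′-borel) B)) [])

    L! : AllPairs (_≢_ on proj₁) L
    L! = AllPairsₚ.++⁺ (AllPairsₚ.map⁺ A!) (AllPairsₚ.++⁺ (AllPairsₚ.map⁺ B!) [] (All.universal (λ _ → []) _))
      (Allₚ.map⁺ (All.tabulate λ a∈A → Allₚ.++⁺
        (Allₚ.map⁺ (All.tabulate λ { b∈B ≡.refl → A#B (a∈A , b∈B) })) []))

    all⇒ : ∀ {ω} → (On A G ∩ On B G′) ω → ∀ i → hit (lookup L i) ω
    all⇒ (onA , onB) i = All.lookup (Allₚ.++⁺ (Allₚ.map⁺ (All.tabulate λ {a} → onA a))
      (Allₚ.++⁺ (Allₚ.map⁺ (All.tabulate λ {b} → onB b)) [])) (∈-lookup i)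

    ⇒all : ∀ {ω} → (∀ i → hit (lookup L i) ω) → (On A G ∩ On B G′) ω
    ⇒all {ω} hits with Allₚ.++⁻ (A with-tag G) (all-hits L hits)
    ... | onA , onB++[] = (λ a a∈A → All.lookup (Allₚ.map⁻ onA) a∈A)
      , (λ b b∈B → All.lookup (Allₚ.map⁻ (Allₚ.++⁻ˡ (B with-tag G′) onB++[])) b∈B)

-- Collision probabilities and the variance

module Collisions {R : Reals} {P : ProbabilitySpace R} {𝕊 : Set}
  {h : 𝕊 → ProbabilitySpace.Ω P → Reals.ℝ R} (H : IsRandomHash P h) (p q r : ℕ) where
  open Reals R
  open OrderedFieldProperties orderedField
  open PowerInequalities R
  open BorelSets R
  open Cells R p q r using (ranks)
  open Buckets R p q r
  open HyperMinHash R
  open ProbabilitySpace P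
  open FiniteProbability P
  open Moments P
  open RandomHashing H
  open import Relation.Binary.Reasoning.Setoid setoid

  module _ (i : Fin K) (k : ℕ) where
    miss : ℝ
    miss = 1# - mass i k

    below-event : ∀ a → IsEvent (h a ⊢ Below i k)
    below-event a = event-h a (below? i k) (borel-Below i k)

    ℙ-Below : ∀ a → ℙ (h a ⊢ Below i k) ≈ mass i k
    ℙ-Below a = begin
      ℙ (h a ⊢ Below i k)
        ≈⟨ ℙ-≐ ((λ b → proj₂ (below i k) b) , (λ b → proj₁ (below i k) b)) ⟩
      ℙ ((h a ⊢ Segment i k) ∩ ∁ (h a ⊢ (_≤ lo i)))
        ≈⟨ ℙ-∖ (event-h a (segment? i k) (borel-initialSegment (proj₂ (segment i k))))
               (event-h a (_≤? lo i) (ray (lo i))) inj₁ ⟩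
      ℙ (h a ⊢ Segment i k) - ℙ (h a ⊢ (_≤ lo i))
        ≈⟨ +-cong (ℙ-initialSegment (proj₂ (segment i k))
                    (≤.trans (0≤lo i) (lo≤end i k)) (≤.trans (end≤hi i k) (hi≤1 i)) a)
                  (-‿cong (IsRandomHash.uniform H a (lo i) (0≤lo i) (≤.trans (lo≤hi i) (hi≤1 i)))) ⟩
      mass i k ∎

    ℙ-miss : ∀ a → ℙ (h a ⊢ ∁ (Below i k)) ≈ miss
    ℙ-miss a = trans (ℙ-∁ (below-event a)) (+-congˡ (-‿cong (ℙ-Below a)))

    borel-miss : Borel (∁ (Below i k))
    borel-miss = complement (borel-Below i k)

    miss? : Decidable (∁ (Below i k))
    miss? y = ¬? (below? i k y)

    1-β≤miss : 1# - β ≤ miss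
    1-β≤miss = +-monoʳ-≤ 1# (neg-mono-≤ (mass≤β i k))

    miss≤1 : miss ≤ 1#
    miss≤1 = 0≤mass i k ≤-by solve 1 (λ u → con (+ 1) := con (+ 1) :- u :+ u) refl (mass i k)

  miss-mono : ∀ i k → miss i (suc k) ≤ miss i k
  miss-mono i k = +-monoʳ-≤ 1# (neg-mono-≤ (mass-mono i k))

  -- Distinct buckets are disjoint, so the masses of the two sets to be missed add up.
  ℙ-miss₂ : ∀ {i j} → i ≢ j → ∀ k l a →
    ℙ (h a ⊢ (∁ (Below i k) ∩ ∁ (Below j l))) ≈ w (miss i k) (miss j l)
  ℙ-miss₂ {i} {j} i≢j k l a = begin
    ℙ (h a ⊢ (∁ (Below i k) ∩ ∁ (Below j l)))
      ≈⟨ ℙ-≐ ((λ (¬b , ¬b′) → [ ¬b , ¬b′ ]) , (λ ¬b∪b′ → ¬b∪b′ ∘ inj₁ , ¬b∪b′ ∘ inj₂)) ⟩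
    ℙ (∁ ((h a ⊢ Below i k) ∪ (h a ⊢ Below j l)))
      ≈⟨ ℙ-∁ (event-∪ (below-event i k a) (below-event j l a)) ⟩
    1# - ℙ ((h a ⊢ Below i k) ∪ (h a ⊢ Below j l))
      ≈⟨ +-congˡ (-‿cong (trans
           (ℙ-∪ (below-event i k a) (below-event j l a)
             (λ (y∈i , _) (y∈j , _) → buckets-disjoint i≢j y∈i y∈j))
           (+-cong (ℙ-Below i k a) (ℙ-Below j l a)))) ⟩
    1# - (mass i k + mass j l)
      ≈⟨ solve 2 (λ u v → con (+ 1) :- (u :+ v) := con (+ 1) :- u :+ (con (+ 1) :- v) :- con (+ 1))
           refl (mass i k) (mass j l) ⟩
    w (miss i k) (miss j l) ∎

  M : List 𝕊 → Fin K → Ω → ℕ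
  M A i ω = bucketMin (λ a → h a ω) i A

  M≥ M≡ : List 𝕊 → Fin K → ℕ → Pred Ω 0ℓ
  M≥ A i k ω = k ℕ.≤ M A i ω
  M≡ A i k ω = M A i ω ≡ k

  M≥-On : ∀ A i {k} → k ℕ.≤ ranks → M≥ A i k ≐ On A (∁ (Below i k))
  M≥-On A i k≤ranks = (λ {ω} → bucketMin-≥⁻ (λ a → h a ω) i A)
                    , (λ {ω} → bucketMin-≥⁺ (λ a → h a ω) i A k≤ranks)

  M-rv : ∀ A i → RandomVariable (M A i)
  M-rv A i = rv-of-tails tails
    where
    tails : ∀ k → IsEvent (M≥ A i k)
    tails k with k ℕₚ.≤? ranks
    ... | yes k≤ranks = event-≐ (swap (M≥-On A i k≤ranks)) (event-On A (miss? i k) (borel-miss i k))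
    ... | no  k≰ranks = event-≐
            ((λ ()) , (λ {ω} k≤M → ⊥-elim (k≰ranks (ℕₚ.≤-trans k≤M (bucketMin≤ranks (λ a → h a ω) i A)))))
            event-∅

  module _ {A B : List 𝕊} (A! : Unique A) (B! : Unique B) (A#B : Disjoint A B) where
    private
      n m : ℕ
      n = length A
      m = length B

    collides : Fin K → Ω → ℕ
    collides i ω = Z (λ a → h a ω) p q r A B i

    collides-rv : ∀ i → RandomVariable (collides i)
    collides-rv i k = measurable-≐
      ( (λ {ω} eq → ≡.trans (Z≡agree (λ a → h a ω) i A B) eq)
      , (λ {ω} eq → ≡.trans (≡.sym (Z≡agree (λ a → h a ω) i A B)) eq))
      (rv-map₂ agree (M-rv A i) (M-rv B i) k)

    Collision Agreement : Fin K → Pred Ω 0ℓ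
    Collision i ω = collides i ω ≡ 1
    Agreement i ω = M A i ω ≡ M B i ω

    agreement-event : ∀ i → IsEvent (Agreement i)
    agreement-event i = event-∈₂ (M-rv A i) (M-rv B i) ℕₚ._≟_

    <ranks-event : ∀ i → IsEvent (λ ω → M A i ω ℕ.< ranks)
    <ranks-event i = event-∈ (M-rv A i) (ℕₚ._<? ranks)

    collision-≐ : ∀ i → Collision i ≐ (Agreement i ∩ λ ω → M A i ω ℕ.< ranks)
    collision-≐ i =
        (λ {ω} Z≡1 → agree≡1⇒ (M A i ω) (M B i ω) (≡.trans (≡.sym (Z≡agree (λ a → h a ω) i A B)) Z≡1))
      , (λ {ω} (eq , <ranks) → ≡.trans (Z≡agree (λ a → h a ω) i A B) (agree-yes eq <ranks))

    -- For k < `ranks`, the probability that the minimum of n hash values in bucket i has rank k.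
    drop : ℕ → Fin K → ℕ → ℝ
    drop n i k = miss i k ^ n - miss i (suc k) ^ n

    ℙ-collision : ∀ i → ℙ (Collision i) ≈ sum {ranks} (λ k → drop n i (toℕ k) * drop m i (toℕ k))
    ℙ-collision i = begin
      ℙ (Collision i)
        ≈⟨ ℙ-≐ (collision-≐ i) ⟩
      ℙ (Agreement i ∩ λ ω → M A i ω ℕ.< ranks)
        ≈⟨ total-probability (M-rv A i) (agreement-event i) ranks ⟩
      sum {ranks} (λ k → ℙ (Agreement i ∩ M≡ A i (toℕ k)))
        ≈⟨ sum-cong-≋ {ranks} (λ k → trans
             (ℙ-≐ ( (λ (eq , A≡k) → tt , A≡k , ≡.trans (≡.sym eq) A≡k)
                  , (λ (_ , A≡k , B≡k) → ≡.trans A≡k (≡.sym B≡k) , A≡k)))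
             (both (toℕ k) (Finₚ.toℕ<n k))) ⟩
      sum {ranks} (λ k → drop n i (toℕ k) * drop m i (toℕ k)) ∎
      where
      tails : ∀ {k l} → k ℕ.≤ ranks → l ℕ.≤ ranks →
              ℙ (U ∩ (M≥ A i k ∩ M≥ B i l)) ≈ miss i k ^ n * miss i l ^ m
      tails {k} {l} k≤ l≤ = trans
        (ℙ-≐ ( (λ (_ , a , b) → proj₁ (M≥-On A i k≤) a , proj₁ (M≥-On B i l≤) b)
             , (λ (a , b) → tt , proj₂ (M≥-On A i k≤) a , proj₂ (M≥-On B i l≤) b)))
        (ℙ-On-∩ A! B! A#B (borel-miss i k) (borel-miss i l) (ℙ-miss i k) (ℙ-miss i l))

      both : ∀ k → k ℕ.< ranks → ℙ (U ∩ (M≡ A i k ∩ M≡ B i k)) ≈ drop n i k * drop m i k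
      both k k< = trans (ℙ-≡-≡ (M-rv A i) (M-rv B i) event-U k k) (trans
        (+-cong (+-cong (+-cong (tails k≤ k≤) (-‿cong (tails k< k≤))) (-‿cong (tails k≤ k<))) (tails k< k<))
        (solve 4 (λ a a′ b b′ → a :* b :- a′ :* b :- a :* b′ :+ a′ :* b′ := (a :- a′) :* (b :- b′)) refl
          (miss i k ^ n) (miss i (suc k) ^ n) (miss i k ^ m) (miss i (suc k) ^ m)))
        where k≤ = ℕₚ.<⇒≤ k<

    module _ {i j : Fin K} (i≢j : i ≢ j) where
      private
        W : ℕ → ℕ → ℕ → ℝ
        W n k l = w (miss i k) (miss j l) ^ n

        □W : ℕ → ℕ → ℕ → ℝ
        □W n k l = □ (λ x z → w x z ^ n) (miss i k) (miss i (suc k)) (miss j l) (miss j (suc l))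

        M≥² M≡² : List 𝕊 → ℕ → ℕ → Pred Ω 0ℓ
        M≥² A k l = M≥ A i k ∩ M≥ A j l
        M≡² A k l = M≡ A i k ∩ M≡ A j l

        M≥²-event : ∀ A k l → IsEvent (M≥² A k l)
        M≥²-event A k l = event-∩ (event-≥ (M-rv A i) k) (event-≥ (M-rv A j) l)

        M≡²-event : ∀ A k l → IsEvent (M≡² A k l)
        M≡²-event A k l = event-∩ (event-≡ (M-rv A i) k) (event-≡ (M-rv A j) l)

        M≥²-On : ∀ A {k l} → k ℕ.≤ ranks → l ℕ.≤ ranks →
                 M≥² A k l ≐ On A (∁ (Below i k) ∩ ∁ (Below j l))
        M≥²-On A k≤ l≤ =
            (λ (x , y) a a∈A → proj₁ (M≥-On A i k≤) x a a∈A , proj₁ (M≥-On A j l≤) y a a∈A)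
          , (λ on → proj₂ (M≥-On A i k≤) (λ a a∈A → proj₁ (on a a∈A))
                  , proj₂ (M≥-On A j l≤) (λ a a∈A → proj₂ (on a a∈A)))

        borel-miss₂ : ∀ k l → Borel (∁ (Below i k) ∩ ∁ (Below j l))
        borel-miss₂ k l = borel-∩ (miss? i k) (miss? j l) (borel-miss i k) (borel-miss j l)

        tails : ∀ {k l k′ l′} → k′ ℕ.≤ ranks → l′ ℕ.≤ ranks → k ℕ.≤ ranks → l ℕ.≤ ranks →
                ℙ (M≥² B k′ l′ ∩ M≥² A k l) ≈ W m k′ l′ * W n k l
        tails {k} {l} {k′} {l′} k′≤ l′≤ k≤ l≤ = trans
          (ℙ-≐ ( (λ (b , a) → proj₁ (M≥²-On A k≤ l≤) a , proj₁ (M≥²-On B k′≤ l′≤) b)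
               , (λ (a , b) → proj₂ (M≥²-On B k′≤ l′≤) b , proj₂ (M≥²-On A k≤ l≤) a)))
          (trans (ℙ-On-∩ A! B! A#B (borel-miss₂ k l) (borel-miss₂ k′ l′)
                   (ℙ-miss₂ i≢j k l) (ℙ-miss₂ i≢j k′ l′))
                 (*-comm _ _))

        factor : ∀ c a₁ a₂ a₃ a₄ → c * a₁ - c * a₂ - c * a₃ + c * a₄ ≈ c * (a₁ - a₂ - a₃ + a₄)
        factor = solve 5 (λ c a₁ a₂ a₃ a₄ →
          c :* a₁ :- c :* a₂ :- c :* a₃ :+ c :* a₄ := c :* (a₁ :- a₂ :- a₃ :+ a₄)) refl

        -- Half of a fourfold difference: exact ranks for `A` but still tails for `B`, ready for a
        -- second use of `ℙ-≡-≡` in `B`.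
        tails-A : ∀ {k l k′ l′} → k′ ℕ.≤ ranks → l′ ℕ.≤ ranks → k ℕ.< ranks → l ℕ.< ranks →
                  ℙ (M≡² A k l ∩ M≥² B k′ l′) ≈ □W n k l * W m k′ l′
        tails-A {k} {l} {k′} {l′} k′≤ l′≤ k< l< = begin
          ℙ (M≡² A k l ∩ M≥² B k′ l′)
            ≈⟨ ℙ-≐ (swap , swap) ⟩
          ℙ (M≥² B k′ l′ ∩ M≡² A k l)
            ≈⟨ ℙ-≡-≡ (M-rv A i) (M-rv A j) (M≥²-event B k′ l′) k l ⟩
          ℙ (M≥² B k′ l′ ∩ M≥² A k l) - ℙ (M≥² B k′ l′ ∩ M≥² A (suc k) l)
            - ℙ (M≥² B k′ l′ ∩ M≥² A k (suc l)) + ℙ (M≥² B k′ l′ ∩ M≥² A (suc k) (suc l))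
            ≈⟨ +-cong (+-cong (+-cong (tails k′≤ l′≤ k≤ l≤) (-‿cong (tails k′≤ l′≤ k< l≤)))
                              (-‿cong (tails k′≤ l′≤ k≤ l<))) (tails k′≤ l′≤ k< l<) ⟩
          W m k′ l′ * W n k l - W m k′ l′ * W n (suc k) l
            - W m k′ l′ * W n k (suc l) + W m k′ l′ * W n (suc k) (suc l)
            ≈⟨ trans (factor _ _ _ _ _) (*-comm _ _) ⟩
          □W n k l * W m k′ l′ ∎
          where
          k≤ = ℕₚ.<⇒≤ k<
          l≤ = ℕₚ.<⇒≤ l<

        point : ∀ {k l} → k ℕ.< ranks → l ℕ.< ranks →
                ℙ (M≡² A k l ∩ M≡² B k l) ≈ □W n k l * □W m k l
        point {k} {l} k< l< = trans (ℙ-≡-≡ (M-rv B i) (M-rv B j) (M≡²-event A k l) k l) (trans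
          (+-cong (+-cong (+-cong (tails-A k≤ l≤ k< l<) (-‿cong (tails-A k< l≤ k< l<)))
                          (-‿cong (tails-A k≤ l< k< l<))) (tails-A k< l< k< l<))
          (factor _ _ _ _ _))
          where
          k≤ = ℕₚ.<⇒≤ k<
          l≤ = ℕₚ.<⇒≤ l<

      ℙ-two-collisions : ℙ (Collision i ∩ Collision j)
        ≈ sum {ranks} (λ k → sum {ranks} (λ l → □W n (toℕ k) (toℕ l) * □W m (toℕ k) (toℕ l)))
      ℙ-two-collisions = begin
        ℙ (Collision i ∩ Collision j)
          ≈⟨ ℙ-≐ ( (λ (c , c′) → let (eq , <r) = proj₁ (collision-≐ i) c
                                     (eq′ , <r′) = proj₁ (collision-≐ j) c′
                                 in (eq , eq′ , <r′) , <r)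
                 , (λ ((eq , eq′ , <r′) , <r) → proj₂ (collision-≐ i) (eq , <r) , proj₂ (collision-≐ j) (eq′ , <r′))) ⟩
        ℙ ((Agreement i ∩ (Agreement j ∩ λ ω → M A j ω ℕ.< ranks)) ∩ λ ω → M A i ω ℕ.< ranks)
          ≈⟨ total-probability (M-rv A i)
               (event-∩ (agreement-event i) (event-∩ (agreement-event j) (<ranks-event j))) ranks ⟩
        sum {ranks} (λ k → ℙ ((Agreement i ∩ (Agreement j ∩ λ ω → M A j ω ℕ.< ranks)) ∩ M≡ A i (toℕ k)))
          ≈⟨ sum-cong-≋ {ranks} (λ k → trans
               (ℙ-≐ ( (λ ((eq , eq′ , <r′) , A≡k) → (eq , A≡k , eq′) , <r′)
                    , (λ ((eq , A≡k , eq′) , <r′) → (eq , eq′ , <r′) , A≡k)))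
               (total-probability (M-rv A j)
                 (event-∩ (agreement-event i) (event-∩ (event-≡ (M-rv A i) (toℕ k)) (agreement-event j))) ranks)) ⟩
        sum {ranks} (λ k → sum {ranks} (λ l →
          ℙ ((Agreement i ∩ (M≡ A i (toℕ k) ∩ Agreement j)) ∩ M≡ A j (toℕ l))))
          ≈⟨ sum-cong-≋ {ranks} (λ k → sum-cong-≋ {ranks} (λ l → trans
               (ℙ-≐ ( (λ ((eq , A≡k , eq′) , A≡l) →
                         (A≡k , A≡l) , ≡.trans (≡.sym eq) A≡k , ≡.trans (≡.sym eq′) A≡l)
                    , (λ ((A≡k , A≡l) , B≡k , B≡l) →
                         (≡.trans A≡k (≡.sym B≡k) , A≡k , ≡.trans A≡l (≡.sym B≡l)) , A≡l)))
               (point (Finₚ.toℕ<n k) (Finₚ.toℕ<n l)))) ⟩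
        sum {ranks} (λ k → sum {ranks} (λ l → □W n (toℕ k) (toℕ l) * □W m (toℕ k) (toℕ l))) ∎

      two-collisions-≤ :
        (1# - β) * (1# - β) * ℙ (Collision i ∩ Collision j) ≤ ℙ (Collision i) * ℙ (Collision j)
      two-collisions-≤ = R≤.begin
        γ * γ * ℙ (Collision i ∩ Collision j)
          R≤.≈⟨ *-congˡ ℙ-two-collisions ⟩
        γ * γ * sum {ranks} (λ k → sum {ranks} (λ l → □W n (toℕ k) (toℕ l) * □W m (toℕ k) (toℕ l)))
          R≤.≈⟨ trans (*-distribˡ-sum {ranks} (γ * γ) _)
                  (sum-cong-≋ {ranks} (λ k → *-distribˡ-sum {ranks} (γ * γ) _)) ⟩
        sum {ranks} (λ k → sum {ranks} (λ l → γ * γ * (□W n (toℕ k) (toℕ l) * □W m (toℕ k) (toℕ l))))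
          R≤.≤⟨ sum-mono-≤ {ranks} (λ k → sum-mono-≤ {ranks} (λ l → termwise (toℕ k) (toℕ l))) ⟩
        sum {ranks} (λ k → sum {ranks} (λ l → e i (toℕ k) * e j (toℕ l)))
          R≤.≈⟨ sum-cong-≋ {ranks} (λ k → *-distribˡ-sum {ranks} (e i (toℕ k)) _) ⟨
        sum {ranks} (λ k → e i (toℕ k) * sum {ranks} (e j ∘ toℕ))
          R≤.≈⟨ *-distribʳ-sum {ranks} (sum {ranks} (e j ∘ toℕ)) (e i ∘ toℕ) ⟨
        sum {ranks} (e i ∘ toℕ) * sum {ranks} (e j ∘ toℕ)
          R≤.≈⟨ *-cong (ℙ-collision i) (ℙ-collision j) ⟨
        ℙ (Collision i) * ℙ (Collision j) R≤.∎
        where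
        γ : ℝ
        γ = 1# - β

        e : Fin K → ℕ → ℝ
        e i k = drop n i k * drop m i k

        -- The distinct indices i and j themselves provide two buckets, and thereby γ ≥ 1/2.
        2≤K : 2 ℕ.≤ K
        2≤K = distinct⇒2≤ i≢j
          where
          distinct⇒2≤ : ∀ {N} {i j : Fin N} → i ≢ j → 2 ℕ.≤ N
          distinct⇒2≤ {suc zero} {Fin.zero} {Fin.zero} i≢j = ⊥-elim (i≢j ≡.refl)
          distinct⇒2≤ {suc (suc _)} _ = s≤s (s≤s z≤n)

        1≤2γ : 1# ≤ 2# * γ
        1≤2γ = 1≤2[1-β] 2≤K Kβ≈1

        γ≤1 : γ ≤ 1#
        γ≤1 = ≤.trans (1-β≤miss i 0) (miss≤1 i 0)

        0≤γ : 0# ≤ γ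
        0≤γ = *-cancel-nonneg 0<2 (≤.trans 0≤1 1≤2γ)

        0≤w : ∀ k l → 0# ≤ w (miss i k) (miss j l)
        0≤w k l = ≤.trans (≤.trans (x≤y⇒0≤y-x 1≤2γ)
            (≤.reflexive (solve 1 (λ γ → con (+ 2) :* γ :- con (+ 1) := γ :+ γ :- con (+ 1)) refl γ)))
          (+-monoˡ-≤ (- 1#) (+-mono-≤ (1-β≤miss i k) (1-β≤miss j l)))

        0≤γ□W : ∀ n k l → 0# ≤ γ * □W n k l
        0≤γ□W n k l = *-nonneg 0≤γ (□-w^-nonneg (0≤w (suc k) (suc l)) (miss-mono i k) (miss-mono j l) n)

        γ□W≤ : ∀ n k l → γ * □W n k l ≤ drop n i k * drop n j l
        γ□W≤ n k l = mixed-difference-≤ 1≤2γ γ≤1 n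
          (1-β≤miss i (suc k)) (miss-mono i k) (miss≤1 i k) (1-β≤miss j (suc l)) (miss-mono j l) (miss≤1 j l)

        -- One factor γ goes to `A` and one to `B`. Multiplying the two bounds requires nonnegative
        -- left-hand sides; the four drops are then regrouped by bucket instead of by set.
        termwise : ∀ k l → γ * γ * (□W n k l * □W m k l) ≤ e i k * e j l
        termwise k l = ≤.trans
          (≤.reflexive (solve 3 (λ g a b → g :* g :* (a :* b) := g :* a :* (g :* b)) refl γ (□W n k l) (□W m k l)))
          (≤.trans (*-mono-≤ (0≤γ□W n k l) (0≤γ□W m k l) (γ□W≤ n k l) (γ□W≤ m k l))
            (≤.reflexive (solve 4 (λ a b c d → a :* b :* (c :* d) := a :* c :* (b :* d)) refl
              (drop n i k) (drop n j l) (drop m i k) (drop m j l))))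

    collides≤1 : ∀ i ω → collides i ω ℕ.≤ 1
    collides≤1 i ω = collision≤1 (f (λ a → h a ω) p q r A i) (f (λ a → h a ω) p q r B i)

    variance-bound : ∀ {b} (C≤b : ∀ ω → C (λ a → h a ω) p q r A B ℕ.≤ b) →
      Var (λ ω → C (λ a → h a ω) p q r A B) C≤b
        ≤ Mean (λ ω → C (λ a → h a ω) p q r A B) C≤b ^ 2 + Mean (λ ω → C (λ a → h a ω) p q r A B) C≤b
    variance-bound C≤b = R≤.begin
      Var X C≤b
        R≤.≈⟨ Var-Σ collides-rv collides≤1 C≤b ⟩
      sum {K} (λ i → sum {K} (λ j → ℙ (Collision i ∩ Collision j))) - μ * μ
        -- The second moment is bounded with twice the squared mean; the subtracted square leaves
        -- one.
        R≤.≤⟨ +-monoˡ-≤ (- (μ * μ)) (pairwise-bound {K} (ℙ ∘ Collision) _ Kβ≈1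
                (λ i → ℙ-≐ (proj₁ , λ c → c , c)) (λ i j → two-collisions-≤)) ⟩
      μ′ + 2# * (μ′ * μ′) - μ * μ
        R≤.≈⟨ +-congʳ (+-cong μ≈ (*-congˡ (*-cong μ≈ μ≈))) ⟨
      μ + 2# * (μ * μ) - μ * μ
        R≤.≈⟨ solve 1 (λ μ → μ :+ con (+ 2) :* (μ :* μ) :- μ :* μ := μ :* (μ :* con (+ 1)) :+ μ) refl μ ⟩
      μ ^ 2 + μ R≤.∎
      where
      X : Ω → ℕ
      X ω = C (λ a → h a ω) p q r A B
      μ μ′ : ℝ
      μ = Mean X C≤b
      μ′ = sum {K} (ℙ ∘ Collision)
      μ≈ : μ ≈ μ′
      μ≈ = Mean-Σ collides-rv collides≤1 C≤b

theorem2 :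
  (R : Reals) (P : ProbabilitySpace R) →
  let open Reals R
      open ProbabilitySpace P
      open HyperMinHash R
  in
  (𝕊 : Set) (h : 𝕊 → Ω → ℝ) → IsRandomHash P h →
  (p q r n m : ℕ) (A B : List 𝕊) →
  Unique A → Unique B → Disjoint A B →
  length A ≡ n → length B ≡ m → n > m →
  let collisions = λ (ω : Ω) → C (λ a → h a ω) p q r A B
      bounded    = λ (ω : Ω) → C≤2^p (λ a → h a ω) p q r A B
  in
  Var collisions bounded
    ≤ Mean collisions bounded ^ 2 + Mean collisions bounded
theorem2 R P 𝕊 h H p q r n m A B A! B! A#B _ _ _ =
  Collisions.variance-bound H p q r A! B! A#B
    (λ ω → HyperMinHash.C≤2^p R (λ a → h a ω) p q r A B)
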